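{- For $|q|<1$, $$\mathrm{C}\Phi_8(q)=\frac{1}{(q;q)_\infty^8}\Big(\Theta_3^7(q^4)+28\Theta_3^6(q^4)\Theta_2(q^4)+105\Theta_3^5(q^4)\Theta_2^2(q^4)+112\Theta_3^4(q^4)\Theta_2^3(q^4)$$ $$+147\Theta_3^3(q^4)\Theta_2^4(q^4)+84\Theta_3^2(q^4)\Theta_2^5(q^4)+35\Theta_3(q^4)\Theta_2^6(q^4)\Big).$$
   Context: A $k$-colored generalized Frobenius symbol is a two-row array with $d\ge 0$ columns whose entries are colored nonnegative integers $\ell_c$ ($\ell\ge 0$, color $c\in\{1,\dots,k\}$), each row strictly decreasing with respect to the total order $0_1\prec 0_2\prec\cdots\prec 0_k\prec 1_1\prec\cdots\prec 1_k\prec 2_1\prec\cdots$. It is a $k$-colored generalized Frobenius partition of $n=d+\sum(\text{integer values of all entries})$. $c\phi_k(n)$ is the number of such partitions of $n$ (with $c\phi_k(0)=1$), and $\mathrm{C}\Phi_k(q)=\sum_{n\ge0}c\phi_k(n)q^n$. $(a;q)_\infty=\prod_{j\ge1}(1-aq^{j-1})$, $\Theta_3(x)=\sum_{j\in\mathbf Z}x^{j^2}$ and $\Theta_2(x)=\sum_{j\in\mathbf Z}x^{(j+1/2)^2}$. -}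

module Defs where

open import Data.Nat as ℕ using (ℕ; zero; suc)
open import Data.Integer as ℤ using (ℤ; +_; -_)
open import Data.Fin using (Fin; toℕ)
open import Data.List using (List; []; _∷_; length; map; upTo; zipWith; foldr)
open import Data.Nat.ListAction using (sum)
open import Data.Vec using (Vec; []; _∷_; head; toList)
open import Data.List.Relation.Unary.Linked using (Linked)
open import Data.Product using (_×_; Σ)
open import Data.Sum using (_⊎_)
open import Relation.Binary.PropositionalEquality using (_≡_)
open import Relation.Nullary.Decidable using (⌊_⌋)
open import Data.Bool using (if_then_else_)
open import Function.Bundles using (_↔_)

-- Colored nonnegative integers ℓ_c, ℓ ∈ ℕ, colour c ∈ Fin k (colour c+1 in the paper)

ColNat : ℕ → Set
ColNat k = ℕ × Fin k

value : ∀ {k} → ColNat k → ℕ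
value (ℓ Data.Product., _) = ℓ

_≺_ : ∀ {k} → ColNat k → ColNat k → Set
(a Data.Product., c) ≺ (b Data.Product., d) = (a ℕ.< b) ⊎ ((a ≡ b) × (toℕ c ℕ.< toℕ d))

StrictlyDecreasing : ∀ {k} → List (ColNat k) → Set
StrictlyDecreasing = Linked (λ x y → y ≺ x)

record FrobSym (k : ℕ) : Set where
  constructor frob
  field
    top    : List (ColNat k)
    bottom : List (ColNat k)
    sameLength : length top ≡ length bottom
    topDec     : StrictlyDecreasing top
    bottomDec  : StrictlyDecreasing bottom

weight : ∀ {k} → FrobSym k → ℕ
weight F = length (FrobSym.top F)
           ℕ.+ sum (map value (FrobSym.top F))
           ℕ.+ sum (map value (FrobSym.bottom F))

FrobPartitions : ℕ → ℕ → Set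
FrobPartitions k n = Σ (FrobSym k) (λ F → weight F ≡ n)

HasCardinality : Set → ℕ → Set
HasCardinality A m = A ↔ Fin m

PS : Set
PS = ℕ → ℤ

sumℤ : List ℤ → ℤ
sumℤ = foldr ℤ._+_ (+ 0)

sumRange : ℕ → (ℕ → ℤ) → ℤ
sumRange zero f = f 0
sumRange (suc n) f = sumRange n f ℤ.+ f (suc n)

infixl 6 _+ₛ_
infixl 7 _*ₛ_ _·ₛ_
infixr 8 _^ₛ_

_+ₛ_ : PS → PS → PS
(f +ₛ g) n = f n ℤ.+ g n

_*ₛ_ : PS → PS → PS
(f *ₛ g) n = sumRange n (λ i → f i ℤ.* g (n ℕ.∸ i))

oneₛ : PS
oneₛ zero = + 1
oneₛ (suc _) = + 0

_·ₛ_ : ℤ → PS → PS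
(c ·ₛ f) n = c ℤ.* f n

_^ₛ_ : PS → ℕ → PS
f ^ₛ zero = oneₛ
f ^ₛ suc m = f *ₛ (f ^ₛ m)

-- multiplicative inverse of a series with constant term 1:
-- b₀ = 1, b_n = - Σ_{i=1}^{n} f_i b_{n-i}.  invRev f n = b_n ∷ … ∷ b₀
invRev : PS → (n : ℕ) → Vec ℤ (suc n)
invRev f zero = + 1 ∷ []
invRev f (suc n) =
  (- sumℤ (zipWith ℤ._*_ (map (λ i → f (suc i)) (upTo (suc n))) (toList (invRev f n))))
  ∷ invRev f n

invₛ : PS → PS
invₛ f n = head (invRev f n)

-- (1 - q^j) for j ≥ 1
oneMinusQ^ : ℕ → PS
oneMinusQ^ j n = if ⌊ n ℕ.≟ 0 ⌋ then + 1 else (if ⌊ n ℕ.≟ j ⌋ then - (+ 1) else + 0)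

finEuler : ℕ → PS
finEuler N = foldr (λ i acc → oneMinusQ^ (suc i) *ₛ acc) oneₛ (upTo N)

-- (q;q)_∞ = ∏_{j≥1}(1 - q^j): its q^n coefficient equals that of ∏_{j=1}^{n}(1-q^j)
qqInf : PS
qqInf n = finEuler n n

intRange : ℕ → List ℤ
intRange n = map (λ i → + i ℤ.- + n) (upTo (suc (2 ℕ.* n)))

countInt : (ℤ → ℤ) → ℕ → ℤ
countInt e n = sumℤ (map (λ j → if ⌊ e j ℤ.≟ + n ⌋ then + 1 else + 0) (intRange n))

-- Θ₃(q⁴) = Σ_{j∈ℤ} q^{4j²}  (terms with |j| > n cannot contribute to q^n)
theta3q4 : PS
theta3q4 = countInt (λ j → + 4 ℤ.* (j ℤ.* j))

-- Θ₂(q⁴) = Σ_{j∈ℤ} q^{4(j+1/2)²} = Σ_{j∈ℤ} q^{(2j+1)²}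
theta2q4 : PS
theta2q4 = countInt (λ j → (+ 2 ℤ.* j ℤ.+ + 1) ℤ.* (+ 2 ℤ.* j ℤ.+ + 1))

thetaMon : ℕ → ℕ → PS
thetaMon a b = (theta3q4 ^ₛ a) *ₛ (theta2q4 ^ₛ b)

rhs6p3 : PS
rhs6p3 = invₛ (qqInf ^ₛ 8) *ₛ
  (thetaMon 7 0
   +ₛ ((+ 28 ·ₛ thetaMon 6 1)
   +ₛ ((+ 105 ·ₛ thetaMon 5 2)
   +ₛ ((+ 112 ·ₛ thetaMon 4 3)
   +ₛ ((+ 147 ·ₛ thetaMon 3 4)
   +ₛ ((+ 84 ·ₛ thetaMon 2 5)
   +ₛ (+ 35 ·ₛ thetaMon 1 6)))))))

module Submission where

-- Write θ(z) = ∑ z^m q^(m²/2). A colour class of the two rows is a pair of finite sets, a Maya diagram; moving its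
-- origin shows that its generating function is c · θ(z) (Jacobi's triple product), where c counts the neutral diagrams,
-- and for a large charge only the partitions survive, so c = 1/(q;q)_∞. Hence CΦ₈ = [z⁰] θ(z)⁸ / (q;q)_∞⁸.
-- The substitution (x , y) ↦ (x + y , x − y) turns a product of two theta series into a sum of two such products.
-- Applied to θ·θ, then to the resulting products, it expresses [z⁰] θ(z)⁸ through a = Θ₃(q⁴) and b = Θ₂(q⁴):
-- with A = Θ₃(q²) and B = Θ₂(q²) it equals a (A³ + 3AB²)² + b (3A²B + B³)² + 8 (a + b)³ A² B², where
-- A² = a² + b² and B² = 2ab. All identities without signs are realised as bijections that preserve the exponents.

-- Series in q and z would have to be Laurent in z; for graded sets, taking the coefficient of z⁰ is
-- just passing to a subset. Up to `_≅_` they form a commutative semiring, so the polynomial algebra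
-- is left to the solver with natural coefficients, whose proofs are then bijections. The price is
-- that nothing can be subtracted or halved. Half of a series over the odd numbers therefore has to
-- be a series of its own: the numbers congruent to 1 modulo 4 give `ψ` and `D`, and reflection
-- shows that the other class is a copy. Integers enter once, through `Counts`, and only after the
-- restriction to charge 0, because θ(z) alone has half-integral exponents. The factor 16 comes from
-- the substitution, which halves the coefficient of the square. It is used at three levels, so the
-- coefficient runs through 8, 4, 2, 1; starting from 8 for the exponent m²/2 means a scale of 16.
-- Eight is used as 2³ twice: for these levels, and to separate the colours of a row by three
-- halvings of an index.

open import Defs
open import Level using (0ℓ) renaming (suc to lsuc)
open import Algebra.Bundles using (CommutativeSemiring)
import Algebra.Definitions.RawSemiring as RawSemiring
import Algebra.Structures.Biased as Biased
open import Data.Bool.Base using (if_then_else_)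
open import Data.Empty using (⊥; ⊥-elim)
open import Data.Fin.Base as Fin using (Fin)
import Data.Fin.Properties as Fin
open import Data.Integer.Base as ℤ using (ℤ; +_; -[1+_]; 0ℤ; 1ℤ)
import Data.Integer.Properties as ℤ
import Data.Integer.Tactic.RingSolver as ℤ-Solver
open import Data.List.Base as List using (List; []; _∷_; _∷ʳ_; length; foldr; upTo; applyUpTo; zipWith)
import Data.List.Properties as List
open import Data.List.Relation.Unary.Linked as Linked using (Linked; []; [-]; _∷_)
import Data.List.Relation.Unary.Linked.Properties as Linked
open import Data.Vec.Base using (toList)
open import Data.Nat.ListAction using (sum)
open import Data.Nat.Base as ℕ using (ℕ; zero; suc; _∸_; _≤_; _<_; z≤n; s≤s)
open import Data.Nat.Divisibility using (_∣_; divides; _∣?_; _∣0; ∣-refl; ∣⇒≤; ∣m+n∣m⇒∣n;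
  ∣m∣n⇒∣m+n)
import Data.Nat.Properties as ℕ
import Data.Nat.Tactic.RingSolver as ℕ-Solver
open import Data.Product.Algebra using (×-cong; ×-comm; ×-assoc; ×-distribʳ-⊎)
open import Data.Product.Base using (Σ; _×_; _,_; proj₁; proj₂)
open import Data.Sum.Algebra using (⊎-cong; ⊎-comm; ⊎-assoc)
open import Data.Sum.Base using (_⊎_; inj₁; inj₂)
open import Data.Unit.Base using (⊤; tt)
open import Function.Bundles using (_↔_; Inverse; mk↔ₛ′)
import Function.Properties.Inverse as ↔
open import Relation.Binary.PropositionalEquality using (_≡_; refl; sym; trans; cong; cong₂; subst; module ≡-Reasoning)
open import Relation.Binary.Structures using (IsEquivalence)
open import Relation.Nullary.Decidable using (Dec; yes; no; ⌊_⌋; from-no)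
open import Relation.Nullary.Negation using (¬_; contradiction)


-- The commutative semiring of graded sets

-- A set graded by a weight (a multiple of the exponent of q) and a charge (the exponent of z).
record GSet : Set₁ where
  no-eta-equality
  field
    Carrier : Set
    wt      : Carrier → ℤ
    ch      : Carrier → ℤ

open GSet

infix 4 _≅_

record _≅_ (X Y : GSet) : Set where
  constructor iso
  field
    bij   : Carrier X ↔ Carrier Y
    wt-eq : ∀ x → wt Y (Inverse.to bij x) ≡ wt X x
    ch-eq : ∀ x → ch Y (Inverse.to bij x) ≡ ch X x

open _≅_

infixl 6 _⊕_
infixl 7 _⊗_

_⊕_ : GSet → GSet → GSet
(X ⊕ Y) .Carrier = Carrier X ⊎ Carrier Y
(X ⊕ Y) .wt (inj₁ x) = wt X x
(X ⊕ Y) .wt (inj₂ y) = wt Y y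
(X ⊕ Y) .ch (inj₁ x) = ch X x
(X ⊕ Y) .ch (inj₂ y) = ch Y y

_⊗_ : GSet → GSet → GSet
(X ⊗ Y) .Carrier = Carrier X × Carrier Y
(X ⊗ Y) .wt (x , y) = wt X x ℤ.+ wt Y y
(X ⊗ Y) .ch (x , y) = ch X x ℤ.+ ch Y y

𝟘 𝟙 : GSet
𝟘 .Carrier = ⊥
𝟘 .wt ()
𝟘 .ch ()
𝟙 .Carrier = ⊤
𝟙 .wt _ = 0ℤ
𝟙 .ch _ = 0ℤ

≅-refl : ∀ {X} → X ≅ X
≅-refl = iso ↔.↔-refl (λ _ → refl) (λ _ → refl)

≅-sym : ∀ {X Y} → X ≅ Y → Y ≅ X
≅-sym {X} {Y} i = iso (↔.↔-sym (bij i))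
  (λ y → trans (sym (wt-eq i (I.from y))) (cong (wt Y) (I.strictlyInverseˡ y)))
  (λ y → trans (sym (ch-eq i (I.from y))) (cong (ch Y) (I.strictlyInverseˡ y)))
  where module I = Inverse (bij i)

≅-trans : ∀ {X Y Z} → X ≅ Y → Y ≅ Z → X ≅ Z
≅-trans i j = iso (↔.↔-trans (bij i) (bij j))
  (λ x → trans (wt-eq j _) (wt-eq i x))
  (λ x → trans (ch-eq j _) (ch-eq i x))

⊕-cong : ∀ {X X′ Y Y′} → X ≅ X′ → Y ≅ Y′ → X ⊕ Y ≅ X′ ⊕ Y′
⊕-cong i j = iso (⊎-cong (bij i) (bij j))
  (λ { (inj₁ x) → wt-eq i x ; (inj₂ y) → wt-eq j y })
  (λ { (inj₁ x) → ch-eq i x ; (inj₂ y) → ch-eq j y })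

⊗-cong : ∀ {X X′ Y Y′} → X ≅ X′ → Y ≅ Y′ → X ⊗ Y ≅ X′ ⊗ Y′
⊗-cong i j = iso (×-cong (bij i) (bij j))
  (λ (x , y) → cong₂ ℤ._+_ (wt-eq i x) (wt-eq j y))
  (λ (x , y) → cong₂ ℤ._+_ (ch-eq i x) (ch-eq j y))

gset-semiring : CommutativeSemiring (lsuc 0ℓ) 0ℓ
gset-semiring = record
  { Carrier = GSet
  ; _≈_ = _≅_
  ; _+_ = _⊕_
  ; _*_ = _⊗_
  ; 0# = 𝟘
  ; 1# = 𝟙
  ; isCommutativeSemiring = Biased.isCommutativeSemiringˡ record
    { +-isCommutativeMonoid = Biased.isCommutativeMonoidˡ record
      { isSemigroup = record
        { isMagma = record { isEquivalence = equiv ; ∙-cong = ⊕-cong }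
        ; assoc = λ X Y Z → iso (⊎-assoc 0ℓ (Carrier X) (Carrier Y) (Carrier Z))
            (λ { (inj₁ (inj₁ _)) → refl ; (inj₁ (inj₂ _)) → refl ; (inj₂ _) → refl })
            (λ { (inj₁ (inj₁ _)) → refl ; (inj₁ (inj₂ _)) → refl ; (inj₂ _) → refl }) }
      ; identityˡ = λ X → iso (mk↔ₛ′ (λ { (inj₁ ()) ; (inj₂ x) → x }) inj₂ (λ _ → refl) (λ { (inj₁ ()) ; (inj₂ _) → refl }))
          (λ { (inj₁ ()) ; (inj₂ _) → refl }) (λ { (inj₁ ()) ; (inj₂ _) → refl })
      ; comm = λ X Y → iso (⊎-comm (Carrier X) (Carrier Y))
          (λ { (inj₁ _) → refl ; (inj₂ _) → refl }) (λ { (inj₁ _) → refl ; (inj₂ _) → refl }) }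
    ; *-isCommutativeMonoid = Biased.isCommutativeMonoidˡ record
      { isSemigroup = record
        { isMagma = record { isEquivalence = equiv ; ∙-cong = ⊗-cong }
        ; assoc = λ X Y Z → iso (×-assoc 0ℓ (Carrier X) (Carrier Y) (Carrier Z))
            (λ ((x , y) , z) → sym (ℤ.+-assoc (wt X x) (wt Y y) (wt Z z)))
            (λ ((x , y) , z) → sym (ℤ.+-assoc (ch X x) (ch Y y) (ch Z z))) }
      ; identityˡ = λ X → iso (mk↔ₛ′ proj₂ (tt ,_) (λ _ → refl) (λ _ → refl))
          (λ (_ , x) → sym (ℤ.+-identityˡ (wt X x))) (λ (_ , x) → sym (ℤ.+-identityˡ (ch X x)))
      ; comm = λ X Y → iso (×-comm (Carrier X) (Carrier Y))
          (λ (x , y) → ℤ.+-comm (wt Y y) (wt X x)) (λ (x , y) → ℤ.+-comm (ch Y y) (ch X x)) }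
    ; distribʳ = λ X Y Z → iso (×-distribʳ-⊎ 0ℓ (Carrier X) (Carrier Y) (Carrier Z))
        (λ { (inj₁ _ , _) → refl ; (inj₂ _ , _) → refl })
        (λ { (inj₁ _ , _) → refl ; (inj₂ _ , _) → refl })
    ; zeroˡ = λ X → iso (mk↔ₛ′ proj₁ ⊥-elim (λ ()) (λ ())) (λ ()) (λ ())
    }
  }
  where
  equiv : IsEquivalence _≅_
  equiv = record { refl = ≅-refl ; sym = ≅-sym ; trans = ≅-trans }

-- Polynomial identities over an arbitrary commutative semiring

module ThetaPolynomial {c ℓ} (R : CommutativeSemiring c ℓ) where
  open CommutativeSemiring R
    using (_≈_; _+_; _*_; 1#; setoid; +-cong; *-cong; *-congˡ) renaming (Carrier to 𝕂; refl to ≈-refl)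
  open import Algebra.Definitions.RawSemiring (CommutativeSemiring.rawSemiring R) using (_^_; _×′_)
  open import Algebra.Solver.Ring.NaturalCoefficients.Default R using (solve; _:=_; _:+_; _:*_; _:^_; con)
  open import Relation.Binary.Reasoning.Setoid setoid

  monomial : 𝕂 → 𝕂 → ℕ → ℕ → 𝕂
  monomial a b i j = a ^ i * b ^ j

  -- The coefficients have the form `n ×′ 1#` because the solver evaluates `con n` to exactly this.
  thetaPolynomial : 𝕂 → 𝕂 → 𝕂
  thetaPolynomial a b = m 7 0 + (28 · m 6 1 + (105 · m 5 2 + (112 · m 4 3 + (147 · m 3 4 + (84 · m 2 5 + 35 · m 1 6)))))
    where
    m : ℕ → ℕ → 𝕂
    m = monomial a b
    infixl 7 _·_
    _·_ : ℕ → 𝕂 → 𝕂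
    n · x = (n ×′ 1#) * x

  iterated-square : ∀ x → ((x * x) * (x * x)) * ((x * x) * (x * x)) ≈ x ^ 8
  iterated-square = solve 1 (λ x → ((x :* x) :* (x :* x)) :* ((x :* x) :* (x :* x)) := x :^ 8) ≈-refl

  -- For x = θ the factor `E` with index r collects the charges congruent to r modulo 4. The last
  -- squaring is expanded rather than paired: the first three summands are the products whose
  -- residues cancel modulo 4, and everything in the bracket will have no neutral element.
  eighth-power : ∀ {x P Q a₁ b₁ A B D E₀ E₁ E₂ E₃} →
    x * x ≈ P * a₁ + Q * b₁ → P * P ≈ E₀ * A + E₂ * B → Q * Q ≈ E₂ * A + E₀ * B → P * Q ≈ E₁ * D + E₃ * D →
    let c₀ = (a₁ * a₁) * A + (b₁ * b₁) * B
        c₁ = (a₁ * b₁ + a₁ * b₁) * D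
        c₂ = (a₁ * a₁) * B + (b₁ * b₁) * A
    in x ^ 8 ≈ (c₀ * c₀) * (E₀ * E₀) + (c₂ * c₂) * (E₂ * E₂) + (c₁ * c₁ + c₁ * c₁) * (E₁ * E₃)
             + ((c₀ * c₁ + c₀ * c₁) * (E₀ * E₁) + (c₀ * c₁ + c₀ * c₁) * (E₀ * E₃) + (c₀ * c₂ + c₀ * c₂) * (E₀ * E₂)
               + (c₁ * c₁) * (E₁ * E₁) + (c₁ * c₁) * (E₃ * E₃)
               + (c₁ * c₂ + c₁ * c₂) * (E₁ * E₂) + (c₁ * c₂ + c₁ * c₂) * (E₂ * E₃))
  eighth-power {x} {P} {Q} {a₁} {b₁} {A} {B} {D} {E₀} {E₁} {E₂} {E₃} x² P² Q² PQ = begin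
    x ^ 8
      ≈⟨ solve 1 (λ x → x :^ 8 := ((x :* x) :* (x :* x)) :^ 2) ≈-refl x ⟩
    ((x * x) * (x * x)) ^ 2
      ≈⟨ square (*-cong x² x²) ⟩
    ((P * a₁ + Q * b₁) * (P * a₁ + Q * b₁)) ^ 2
      ≈⟨ square (solve 4 (λ P Q a₁ b₁ → (P :* a₁ :+ Q :* b₁) :* (P :* a₁ :+ Q :* b₁)
           := (a₁ :* a₁) :* (P :* P) :+ (a₁ :* b₁ :+ a₁ :* b₁) :* (P :* Q) :+ (b₁ :* b₁) :* (Q :* Q))
           ≈-refl P Q a₁ b₁) ⟩
    ((a₁ * a₁) * (P * P) + (a₁ * b₁ + a₁ * b₁) * (P * Q) + (b₁ * b₁) * (Q * Q)) ^ 2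
      ≈⟨ square (+-cong (+-cong (*-congˡ P²) (*-congˡ PQ)) (*-congˡ Q²)) ⟩
    ((a₁ * a₁) * (E₀ * A + E₂ * B) + (a₁ * b₁ + a₁ * b₁) * (E₁ * D + E₃ * D) + (b₁ * b₁) * (E₂ * A + E₀ * B)) ^ 2
      ≈⟨ square (solve 10 (λ p r s A B D E₀ E₁ E₂ E₃ →
           p :* (E₀ :* A :+ E₂ :* B) :+ r :* (E₁ :* D :+ E₃ :* D) :+ s :* (E₂ :* A :+ E₀ :* B)
           := (p :* A :+ s :* B) :* E₀ :+ (r :* D) :* E₁ :+ (p :* B :+ s :* A) :* E₂ :+ (r :* D) :* E₃)
           ≈-refl (a₁ * a₁) (a₁ * b₁ + a₁ * b₁) (b₁ * b₁) A B D E₀ E₁ E₂ E₃) ⟩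
    (c₀ * E₀ + c₁ * E₁ + c₂ * E₂ + c₁ * E₃) ^ 2
      ≈⟨ solve 7 (λ c₀ c₁ c₂ E₀ E₁ E₂ E₃ → (c₀ :* E₀ :+ c₁ :* E₁ :+ c₂ :* E₂ :+ c₁ :* E₃) :^ 2
           := (c₀ :* c₀) :* (E₀ :* E₀) :+ (c₂ :* c₂) :* (E₂ :* E₂) :+ (c₁ :* c₁ :+ c₁ :* c₁) :* (E₁ :* E₃)
             :+ ((c₀ :* c₁ :+ c₀ :* c₁) :* (E₀ :* E₁) :+ (c₀ :* c₁ :+ c₀ :* c₁) :* (E₀ :* E₃)
               :+ (c₀ :* c₂ :+ c₀ :* c₂) :* (E₀ :* E₂) :+ (c₁ :* c₁) :* (E₁ :* E₁) :+ (c₁ :* c₁) :* (E₃ :* E₃)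
               :+ (c₁ :* c₂ :+ c₁ :* c₂) :* (E₁ :* E₂) :+ (c₁ :* c₂ :+ c₁ :* c₂) :* (E₂ :* E₃)))
           ≈-refl c₀ c₁ c₂ E₀ E₁ E₂ E₃ ⟩
    _ ∎
    where
    c₀ c₁ c₂ : 𝕂
    c₀ = (a₁ * a₁) * A + (b₁ * b₁) * B
    c₁ = (a₁ * b₁ + a₁ * b₁) * D
    c₂ = (a₁ * a₁) * B + (b₁ * b₁) * A
    square : ∀ {x y} → x ≈ y → x ^ 2 ≈ y ^ 2
    square e = *-cong e (*-cong e ≈-refl)

  module _ {a b A B D ψ a₁ b₁ : 𝕂}
    (a₁² : a₁ * a₁ ≈ A * A + B * B) (b₁² : b₁ * b₁ ≈ B * A + A * B)
    (A² : A * A ≈ a * a + b * b) (B² : B * B ≈ b * a + a * b) (D² : D * D ≈ ψ * a + ψ * b)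
    (a₁-split : a₁ ≈ a + b) (b₁-split : b₁ ≈ ψ + ψ) where

    private
      c₀ c₁ c₂ : 𝕂
      c₀ = (a₁ * a₁) * A + (b₁ * b₁) * B
      c₁ = (a₁ * b₁ + a₁ * b₁) * D
      c₂ = (a₁ * a₁) * B + (b₁ * b₁) * A

      -- Neither A nor B is a polynomial in a and b, but c₀ = A (A² + 3B²), so its square involves
      -- only A² and B². The same holds for c₂ = B (3A² + B²).
      c₀² : c₀ * c₀ ≈ (a * a + b * b) * ((a * a + b * b) + ((b * a + a * b) + (b * a + a * b) + (b * a + a * b))) ^ 2
      c₀² = begin
        c₀ * c₀
          ≈⟨ *-cong c₀≈ c₀≈ ⟩
        ((A * A + B * B) * A + (B * A + A * B) * B) * ((A * A + B * B) * A + (B * A + A * B) * B)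
          ≈⟨ solve 2 (λ A B → let x = (A :* A :+ B :* B) :* A :+ (B :* A :+ A :* B) :* B in
               x :* x := (A :* A) :* (A :* A :+ (B :* B :+ B :* B :+ B :* B)) :^ 2) ≈-refl A B ⟩
        (A * A) * (A * A + (B * B + B * B + B * B)) ^ 2
          ≈⟨ *-cong A² (*-cong s (*-cong s ≈-refl)) ⟩
        (a * a + b * b) * ((a * a + b * b) + ((b * a + a * b) + (b * a + a * b) + (b * a + a * b))) ^ 2 ∎
        where
        c₀≈ = +-cong (*-cong a₁² ≈-refl) (*-cong b₁² ≈-refl)
        s = +-cong A² (+-cong (+-cong B² B²) B²)

      c₂² : c₂ * c₂ ≈ (b * a + a * b) * (((a * a + b * b) + (a * a + b * b) + (a * a + b * b)) + (b * a + a * b)) ^ 2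
      c₂² = begin
        c₂ * c₂
          ≈⟨ *-cong c₂≈ c₂≈ ⟩
        ((A * A + B * B) * B + (B * A + A * B) * A) * ((A * A + B * B) * B + (B * A + A * B) * A)
          ≈⟨ solve 2 (λ A B → let x = (A :* A :+ B :* B) :* B :+ (B :* A :+ A :* B) :* A in
               x :* x := (B :* B) :* ((A :* A :+ A :* A :+ A :* A) :+ B :* B) :^ 2) ≈-refl A B ⟩
        (B * B) * ((A * A + A * A + A * A) + B * B) ^ 2
          ≈⟨ *-cong B² (*-cong s (*-cong s ≈-refl)) ⟩
        (b * a + a * b) * (((a * a + b * b) + (a * a + b * b) + (a * a + b * b)) + (b * a + a * b)) ^ 2 ∎
        where
        c₂≈ = +-cong (*-cong a₁² ≈-refl) (*-cong b₁² ≈-refl)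
        s = +-cong (+-cong (+-cong A² A²) A²) B²

      -- ψ and D occur only through (2ψ)² = b₁² and D² = ψ(a + b), which makes ψ c₁² a polynomial in a and b.
      ψc₁² : (c₁ * c₁ + c₁ * c₁) * ψ ≈ (8 ×′ 1#) * ((a * a + b * b) * (b * a + a * b) * (a + b) ^ 3)
      ψc₁² = begin
        (c₁ * c₁ + c₁ * c₁) * ψ
          ≈⟨ solve 4 (λ a₁ b₁ D ψ → let x = (a₁ :* b₁ :+ a₁ :* b₁) :* D in
               (x :* x :+ x :* x) :* ψ := con 8 :* ((a₁ :^ 2) :* (b₁ :* b₁) :* (D :* D) :* ψ)) ≈-refl a₁ b₁ D ψ ⟩
        (8 ×′ 1#) * (a₁ ^ 2 * (b₁ * b₁) * (D * D) * ψ)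
          ≈⟨ *-congˡ (*-cong (*-cong (*-cong (*-cong a₁-split (*-cong a₁-split ≈-refl)) b₁²) D²) ≈-refl) ⟩
        (8 ×′ 1#) * ((a + b) ^ 2 * (B * A + A * B) * (ψ * a + ψ * b) * ψ)
          ≈⟨ solve 5 (λ a b A B ψ → con 8 :* ((a :+ b) :^ 2 :* (B :* A :+ A :* B) :* (ψ :* a :+ ψ :* b) :* ψ)
               := con 4 :* ((A :* B) :* ((ψ :+ ψ) :* (ψ :+ ψ)) :* (a :+ b) :^ 3)) ≈-refl a b A B ψ ⟩
        (4 ×′ 1#) * ((A * B) * ((ψ + ψ) * (ψ + ψ)) * (a + b) ^ 3)
          ≈⟨ *-congˡ (*-cong (*-congˡ (*-cong b₁-split b₁-split)) ≈-refl) ⟨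
        (4 ×′ 1#) * ((A * B) * (b₁ * b₁) * (a + b) ^ 3)
          ≈⟨ *-congˡ (*-cong (*-congˡ b₁²) ≈-refl) ⟩
        (4 ×′ 1#) * ((A * B) * (B * A + A * B) * (a + b) ^ 3)
          ≈⟨ solve 4 (λ a b A B → con 4 :* ((A :* B) :* (B :* A :+ A :* B) :* (a :+ b) :^ 3)
               := con 8 :* ((A :* A) :* (B :* B) :* (a :+ b) :^ 3)) ≈-refl a b A B ⟩
        (8 ×′ 1#) * ((A * A) * (B * B) * (a + b) ^ 3)
          ≈⟨ *-congˡ (*-cong (*-cong A² B²) ≈-refl) ⟩
        (8 ×′ 1#) * ((a * a + b * b) * (b * a + a * b) * (a + b) ^ 3) ∎

    theta-polynomial : (c₀ * c₀) * a + (c₂ * c₂) * b + (c₁ * c₁ + c₁ * c₁) * ψ ≈ thetaPolynomial a b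
    theta-polynomial = begin
      (c₀ * c₀) * a + (c₂ * c₂) * b + (c₁ * c₁ + c₁ * c₁) * ψ
        ≈⟨ +-cong (+-cong (*-cong c₀² ≈-refl) (*-cong c₂² ≈-refl)) ψc₁² ⟩
      _ ≈⟨ solve 2 (λ a b →
             let α = a :* a :+ b :* b
                 β = b :* a :+ a :* b
                 m = λ i j → a :^ i :* b :^ j
             in (α :* (α :+ (β :+ β :+ β)) :^ 2) :* a :+ (β :* ((α :+ α :+ α) :+ β) :^ 2) :* b
                  :+ con 8 :* (α :* β :* (a :+ b) :^ 3)
             := m 7 0 :+ (con 28 :* m 6 1 :+ (con 105 :* m 5 2 :+ (con 112 :* m 4 3
                  :+ (con 147 :* m 3 4 :+ (con 84 :* m 2 5 :+ con 35 :* m 1 6)))))) ≈-refl a b ⟩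
      thetaPolynomial a b ∎

-- Theta series

halveℕ : ℕ → ℕ ⊎ ℕ
halveℕ zero = inj₁ zero
halveℕ (suc n) with halveℕ n
... | inj₁ k = inj₂ k
... | inj₂ k = inj₁ (suc k)

unhalveℕ : ℕ ⊎ ℕ → ℕ
unhalveℕ (inj₁ k) = k ℕ.+ k
unhalveℕ (inj₂ k) = suc (k ℕ.+ k)

unhalve-halveℕ : ∀ n → unhalveℕ (halveℕ n) ≡ n
unhalve-halveℕ zero = refl
unhalve-halveℕ (suc n) with halveℕ n | unhalve-halveℕ n
... | inj₁ k | e = cong suc e
... | inj₂ k | e = cong suc (trans (ℕ.+-suc k k) e)

halve-evenℕ : ∀ k → halveℕ (k ℕ.+ k) ≡ inj₁ k
halve-oddℕ  : ∀ k → halveℕ (suc (k ℕ.+ k)) ≡ inj₂ k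
halve-evenℕ zero = refl
halve-evenℕ (suc k) rewrite ℕ.+-suc k k | halve-oddℕ k = refl
halve-oddℕ k rewrite halve-evenℕ k = refl

unhalve : ℤ ⊎ ℤ → ℤ
unhalve (inj₁ k) = k ℤ.+ k
unhalve (inj₂ k) = 1ℤ ℤ.+ (k ℤ.+ k)

halve : ℤ → ℤ ⊎ ℤ
halve (+ n) with halveℕ n
... | inj₁ k = inj₁ (+ k)
... | inj₂ k = inj₂ (+ k)
-- Parities swap here, because `-[1+ n ]` is -(n + 1): for n = 2k it equals 1 + 2 (-(k + 1)).
halve -[1+ n ] with halveℕ n
... | inj₁ k = inj₂ -[1+ k ]
... | inj₂ k = inj₁ -[1+ k ]

unhalve-halve : ∀ z → unhalve (halve z) ≡ z
unhalve-halve (+ n) with halveℕ n | unhalve-halveℕ n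
... | inj₁ k | e = cong +_ e
... | inj₂ k | e = cong +_ e
unhalve-halve -[1+ n ] with halveℕ n | unhalve-halveℕ n
... | inj₁ k | e = cong -[1+_] e
... | inj₂ k | e = cong -[1+_] e

halve-unhalve : ∀ x → halve (unhalve x) ≡ x
halve-unhalve (inj₁ (+ k)) rewrite halve-evenℕ k = refl
halve-unhalve (inj₁ -[1+ k ]) rewrite halve-evenℕ k = refl
halve-unhalve (inj₂ (+ k)) rewrite halve-evenℕ k = refl
halve-unhalve (inj₂ -[1+ k ]) rewrite halve-evenℕ k = refl

unhalve-↔ : (ℤ ⊎ ℤ) ↔ ℤ
unhalve-↔ = mk↔ₛ′ unhalve halve unhalve-halve halve-unhalve

-- The pairs of equal parity form a sublattice of index 2, which is the image of `inj₁`; `inj₂`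
-- gives its other coset.
unpair : (ℤ × ℤ) ⊎ (ℤ × ℤ) → ℤ × ℤ
unpair (inj₁ (u , v)) = u ℤ.+ v , u ℤ.- v
unpair (inj₂ (u , v)) = 1ℤ ℤ.+ (u ℤ.+ v) , u ℤ.- v

-- The inverse of unpair takes v = ⌊(s − t)/2⌋ and u = t + v.
unpair-↔ : ((ℤ × ℤ) ⊎ (ℤ × ℤ)) ↔ (ℤ × ℤ)
unpair-↔ = mk↔ₛ′ unpair pair unpair-pair pair-unpair
  where
  attach : ℤ → ℤ ⊎ ℤ → (ℤ × ℤ) ⊎ (ℤ × ℤ)
  attach t (inj₁ v) = inj₁ (t ℤ.+ v , v)
  attach t (inj₂ v) = inj₂ (t ℤ.+ v , v)

  pair : ℤ × ℤ → (ℤ × ℤ) ⊎ (ℤ × ℤ)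
  pair (s , t) = attach t (halve (s ℤ.- t))

  minus-plus : ∀ s t → s ℤ.- t ℤ.+ t ≡ s
  minus-plus = ℤ-Solver.solve-∀

  unpair-attach : ∀ t x → unpair (attach t x) ≡ (unhalve x ℤ.+ t , t)
  unpair-attach t (inj₁ v) = cong₂ _,_ (e₁ t v) (e₂ t v)
    where
    e₁ : ∀ t v → t ℤ.+ v ℤ.+ v ≡ v ℤ.+ v ℤ.+ t
    e₁ = ℤ-Solver.solve-∀
    e₂ : ∀ t v → t ℤ.+ v ℤ.- v ≡ t
    e₂ = ℤ-Solver.solve-∀
  unpair-attach t (inj₂ v) = cong₂ _,_ (e₁ t v) (e₂ t v)
    where
    e₁ : ∀ t v → 1ℤ ℤ.+ (t ℤ.+ v ℤ.+ v) ≡ 1ℤ ℤ.+ (v ℤ.+ v) ℤ.+ t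
    e₁ = ℤ-Solver.solve-∀
    e₂ : ∀ t v → t ℤ.+ v ℤ.- v ≡ t
    e₂ = ℤ-Solver.solve-∀

  unpair-pair : ∀ p → unpair (pair p) ≡ p
  unpair-pair (s , t) = trans (unpair-attach t (halve (s ℤ.- t)))
    (cong (_, t) (trans (cong (ℤ._+ t) (unhalve-halve (s ℤ.- t))) (minus-plus s t)))

  pair-unpair : ∀ x → pair (unpair x) ≡ x
  pair-unpair (inj₁ (u , v)) = trans
    (cong (attach (u ℤ.- v)) (trans (cong halve (e u v)) (halve-unhalve (inj₁ v))))
    (cong (λ w → inj₁ (w , v)) (minus-plus u v))
    where
    e : ∀ u v → u ℤ.+ v ℤ.- (u ℤ.- v) ≡ v ℤ.+ v
    e = ℤ-Solver.solve-∀
  pair-unpair (inj₂ (u , v)) = trans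
    (cong (attach (u ℤ.- v)) (trans (cong halve (e u v)) (halve-unhalve (inj₂ v))))
    (cong (λ w → inj₂ (w , v)) (minus-plus u v))
    where
    e : ∀ u v → 1ℤ ℤ.+ (u ℤ.+ v) ℤ.- (u ℤ.- v) ≡ 1ℤ ℤ.+ (v ℤ.+ v)
    e = ℤ-Solver.solve-∀

-- Σ q^{κx²} z^{λx} over the x congruent to r modulo M
L : (M r κ ƛ : ℤ) → GSet
L M r κ ƛ .Carrier = ℤ
L M r κ ƛ .wt s = κ ℤ.* ((M ℤ.* s ℤ.+ r) ℤ.* (M ℤ.* s ℤ.+ r))
L M r κ ƛ .ch s = ƛ ℤ.* (M ℤ.* s ℤ.+ r)

L-shift : ∀ M r κ ƛ → L M (M ℤ.+ r) κ ƛ ≅ L M r κ ƛ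
L-shift M r κ ƛ = iso
  (mk↔ₛ′ (λ s → s ℤ.+ 1ℤ) (λ s → s ℤ.- 1ℤ) (λ s → e₁ s 1ℤ) (λ s → e₂ s 1ℤ))
  (λ s → cong (λ x → κ ℤ.* (x ℤ.* x)) (e M r s)) (λ s → cong (ƛ ℤ.*_) (e M r s))
  where
  e₁ : ∀ s t → s ℤ.- t ℤ.+ t ≡ s
  e₁ = ℤ-Solver.solve-∀
  e₂ : ∀ s t → s ℤ.+ t ℤ.- t ≡ s
  e₂ = ℤ-Solver.solve-∀
  e : ∀ M r s → M ℤ.* (s ℤ.+ 1ℤ) ℤ.+ r ≡ M ℤ.* s ℤ.+ (M ℤ.+ r)
  e = ℤ-Solver.solve-∀

-- The reflection x ↦ -x reverses the charge, hence the restriction to series without z.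
L-neg : ∀ M r κ → L M (ℤ.- r) κ 0ℤ ≅ L M r κ 0ℤ
L-neg M r κ = iso (mk↔ₛ′ ℤ.-_ ℤ.-_ ℤ.neg-involutive ℤ.neg-involutive) (λ s → e M r κ s) (λ s → refl)
  where
  e : ∀ M r κ s → κ ℤ.* ((M ℤ.* (ℤ.- s) ℤ.+ r) ℤ.* (M ℤ.* (ℤ.- s) ℤ.+ r))
                ≡ κ ℤ.* ((M ℤ.* s ℤ.+ ℤ.- r) ℤ.* (M ℤ.* s ℤ.+ ℤ.- r))
  e = ℤ-Solver.solve-∀

L-split : ∀ M r κ ƛ → L (M ℤ.+ M) r κ ƛ ⊕ L (M ℤ.+ M) (M ℤ.+ r) κ ƛ ≅ L M r κ ƛ
L-split M r κ ƛ = iso unhalve-↔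
  (λ { (inj₁ v) → cong (λ x → κ ℤ.* (x ℤ.* x)) (e₁ M r v) ; (inj₂ v) → cong (λ x → κ ℤ.* (x ℤ.* x)) (e₂ M r v) })
  (λ { (inj₁ v) → cong (ƛ ℤ.*_) (e₁ M r v) ; (inj₂ v) → cong (ƛ ℤ.*_) (e₂ M r v) })
  where
  e₁ : ∀ M r v → M ℤ.* (v ℤ.+ v) ℤ.+ r ≡ (M ℤ.+ M) ℤ.* v ℤ.+ r
  e₁ = ℤ-Solver.solve-∀
  e₂ : ∀ M r v → M ℤ.* (1ℤ ℤ.+ (v ℤ.+ v)) ℤ.+ r ≡ (M ℤ.+ M) ℤ.* v ℤ.+ (M ℤ.+ r)
  e₂ = ℤ-Solver.solve-∀

-- X = x + y and Y = x − y turn 2x² + 2y² into X² + Y²; given x ≡ r and y ≡ r′ modulo M, the pair (X , Y)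
-- ranges over the classes of (r + r′ , r − r′) and (r + r′ + M , r − r′ + M) modulo 2M.
L-pair : ∀ M r r′ κ ƛ →
  L (M ℤ.+ M) (r ℤ.+ r′) κ ƛ ⊗ L (M ℤ.+ M) (r ℤ.- r′) κ 0ℤ
    ⊕ L (M ℤ.+ M) (M ℤ.+ (r ℤ.+ r′)) κ ƛ ⊗ L (M ℤ.+ M) (M ℤ.+ (r ℤ.- r′)) κ 0ℤ
  ≅ L M r (κ ℤ.+ κ) ƛ ⊗ L M r′ (κ ℤ.+ κ) ƛ
L-pair M r r′ κ ƛ = iso unpair-↔
  (λ { (inj₁ (u , v)) → w₁ M r r′ κ u v ; (inj₂ (u , v)) → w₂ M r r′ κ u v })
  (λ { (inj₁ (u , v)) → trans (c₁ M r r′ ƛ u v) (sym (ℤ.+-identityʳ _))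
     ; (inj₂ (u , v)) → trans (c₂ M r r′ ƛ u v) (sym (ℤ.+-identityʳ _)) })
  where
  w₁ : ∀ M r r′ κ u v →
    (κ ℤ.+ κ) ℤ.* ((M ℤ.* (u ℤ.+ v) ℤ.+ r) ℤ.* (M ℤ.* (u ℤ.+ v) ℤ.+ r))
      ℤ.+ (κ ℤ.+ κ) ℤ.* ((M ℤ.* (u ℤ.- v) ℤ.+ r′) ℤ.* (M ℤ.* (u ℤ.- v) ℤ.+ r′))
    ≡ κ ℤ.* (((M ℤ.+ M) ℤ.* u ℤ.+ (r ℤ.+ r′)) ℤ.* ((M ℤ.+ M) ℤ.* u ℤ.+ (r ℤ.+ r′)))
      ℤ.+ κ ℤ.* (((M ℤ.+ M) ℤ.* v ℤ.+ (r ℤ.- r′)) ℤ.* ((M ℤ.+ M) ℤ.* v ℤ.+ (r ℤ.- r′)))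
  w₁ = ℤ-Solver.solve-∀
  w₂ : ∀ M r r′ κ u v →
    (κ ℤ.+ κ) ℤ.* ((M ℤ.* (1ℤ ℤ.+ (u ℤ.+ v)) ℤ.+ r) ℤ.* (M ℤ.* (1ℤ ℤ.+ (u ℤ.+ v)) ℤ.+ r))
      ℤ.+ (κ ℤ.+ κ) ℤ.* ((M ℤ.* (u ℤ.- v) ℤ.+ r′) ℤ.* (M ℤ.* (u ℤ.- v) ℤ.+ r′))
    ≡ κ ℤ.* (((M ℤ.+ M) ℤ.* u ℤ.+ (M ℤ.+ (r ℤ.+ r′))) ℤ.* ((M ℤ.+ M) ℤ.* u ℤ.+ (M ℤ.+ (r ℤ.+ r′))))
      ℤ.+ κ ℤ.* (((M ℤ.+ M) ℤ.* v ℤ.+ (M ℤ.+ (r ℤ.- r′))) ℤ.* ((M ℤ.+ M) ℤ.* v ℤ.+ (M ℤ.+ (r ℤ.- r′))))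
  w₂ = ℤ-Solver.solve-∀
  c₁ : ∀ M r r′ ƛ u v →
    ƛ ℤ.* (M ℤ.* (u ℤ.+ v) ℤ.+ r) ℤ.+ ƛ ℤ.* (M ℤ.* (u ℤ.- v) ℤ.+ r′)
    ≡ ƛ ℤ.* ((M ℤ.+ M) ℤ.* u ℤ.+ (r ℤ.+ r′))
  c₁ = ℤ-Solver.solve-∀
  c₂ : ∀ M r r′ ƛ u v →
    ƛ ℤ.* (M ℤ.* (1ℤ ℤ.+ (u ℤ.+ v)) ℤ.+ r) ℤ.+ ƛ ℤ.* (M ℤ.* (u ℤ.- v) ℤ.+ r′)
    ≡ ƛ ℤ.* ((M ℤ.+ M) ℤ.* u ℤ.+ (M ℤ.+ (r ℤ.+ r′)))
  c₂ = ℤ-Solver.solve-∀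

L-rescale : ∀ M r κ → L (M ℤ.+ M) (r ℤ.+ r) κ 0ℤ ≅ L M r (+ 4 ℤ.* κ) 0ℤ
L-rescale M r κ = iso ↔.↔-refl (λ s → e M r κ s) (λ _ → refl)
  where
  e : ∀ M r κ s → + 4 ℤ.* κ ℤ.* ((M ℤ.* s ℤ.+ r) ℤ.* (M ℤ.* s ℤ.+ r))
    ≡ κ ℤ.* (((M ℤ.+ M) ℤ.* s ℤ.+ (r ℤ.+ r)) ℤ.* ((M ℤ.+ M) ℤ.* s ℤ.+ (r ℤ.+ r)))
  e = ℤ-Solver.solve-∀

-- Constant terms in z

neutral : GSet → GSet
neutral X .Carrier = Σ (Carrier X) (λ x → ch X x ≡ 0ℤ)
neutral X .wt (x , _) = wt X x
neutral X .ch (x , _) = ch X x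

ℤ-uip : ∀ {i j : ℤ} (p q : i ≡ j) → p ≡ q
ℤ-uip refl refl = refl

neutral-≡ : ∀ (X : GSet) {x y : Carrier X} {p : ch X x ≡ 0ℤ} {q : ch X y ≡ 0ℤ} → x ≡ y →
  _≡_ {A = Carrier (neutral X)} (x , p) (y , q)
neutral-≡ X {p = p} {q} refl = cong (_ ,_) (ℤ-uip p q)

neutral-cong : ∀ {X Y} → X ≅ Y → neutral X ≅ neutral Y
neutral-cong {X} {Y} i = iso
  (mk↔ₛ′ (λ (x , p) → I.to x , trans (ch-eq i x) p) (λ (y , p) → I.from y , trans (ch-eq (≅-sym i) y) p)
    (λ (y , _) → neutral-≡ Y (I.strictlyInverseˡ y)) (λ (x , _) → neutral-≡ X (I.strictlyInverseʳ x)))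
  (λ (x , _) → wt-eq i x) (λ (x , _) → ch-eq i x)
  where module I = Inverse (bij i)

neutral-⊕ : ∀ X Y → neutral (X ⊕ Y) ≅ neutral X ⊕ neutral Y
neutral-⊕ X Y = iso
  (mk↔ₛ′ (λ { (inj₁ x , p) → inj₁ (x , p) ; (inj₂ y , p) → inj₂ (y , p) })
         (λ { (inj₁ (x , p)) → inj₁ x , p ; (inj₂ (y , p)) → inj₂ y , p })
         (λ { (inj₁ _) → refl ; (inj₂ _) → refl })
         (λ { (inj₁ _ , _) → refl ; (inj₂ _ , _) → refl }))
  (λ { (inj₁ _ , _) → refl ; (inj₂ _ , _) → refl })
  (λ { (inj₁ _ , _) → refl ; (inj₂ _ , _) → refl })

-- A record rather than a bare function type, so that `X` can be inferred from a proof.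
record Uncharged (X : GSet) : Set where
  constructor uncharged
  field charge : ∀ x → ch X x ≡ 0ℤ

uncharged-⊕ : ∀ {X Y} → Uncharged X → Uncharged Y → Uncharged (X ⊕ Y)
uncharged-⊕ (uncharged u) (uncharged v) = uncharged λ { (inj₁ x) → u x ; (inj₂ y) → v y }

uncharged-⊗ : ∀ {X Y} → Uncharged X → Uncharged Y → Uncharged (X ⊗ Y)
uncharged-⊗ (uncharged u) (uncharged v) = uncharged λ (x , y) → cong₂ ℤ._+_ (u x) (v y)

uncharged-L : ∀ {M r κ} → Uncharged (L M r κ 0ℤ)
uncharged-L = uncharged λ _ → refl

neutral-⊗ : ∀ {C} X → Uncharged C → neutral (C ⊗ X) ≅ C ⊗ neutral X
neutral-⊗ {C} X (uncharged u) = iso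
  (mk↔ₛ′ (λ ((c , x) , p) → c , x , trans (sym (e c x)) p) (λ (c , x , p) → (c , x) , trans (e c x) p)
    (λ (c , x , _) → cong (c ,_) (neutral-≡ X refl)) (λ _ → neutral-≡ (C ⊗ X) refl))
  (λ _ → refl) (λ _ → refl)
  where
  e : ∀ c x → ch C c ℤ.+ ch X x ≡ ch X x
  e c x = trans (cong (ℤ._+ ch X x) (u c)) (ℤ.+-identityˡ (ch X x))

record NeverNeutral (X : GSet) : Set where
  constructor neverNeutral
  field charged : ∀ x → ¬ (ch X x ≡ 0ℤ)

neverNeutral-⊕ : ∀ {X Y} → NeverNeutral X → NeverNeutral Y → NeverNeutral (X ⊕ Y)
neverNeutral-⊕ (neverNeutral u) (neverNeutral v) = neverNeutral λ { (inj₁ x) → u x ; (inj₂ y) → v y }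

neverNeutral-⊗ : ∀ {C X} → Uncharged C → NeverNeutral X → NeverNeutral (C ⊗ X)
neverNeutral-⊗ {C} {X} (uncharged u) (neverNeutral v) = neverNeutral λ (c , x) p →
  v x (trans (sym (ℤ.+-identityˡ (ch X x))) (trans (cong (ℤ._+ ch X x) (sym (u c))) p))

neutral-empty : ∀ {X} → NeverNeutral X → neutral X ≅ 𝟘
neutral-empty (neverNeutral v) = iso
  (mk↔ₛ′ (λ (x , p) → ⊥-elim (v x p)) (λ ()) (λ ()) (λ (x , p) → ⊥-elim (v x p)))
  (λ (x , p) → ⊥-elim (v x p)) (λ (x , p) → ⊥-elim (v x p))

-- The total charge is congruent to r + r′ modulo M.
neverNeutral-L : ∀ M r r′ κ → ¬ (ℤ.∣ M ∣ ∣ ℤ.∣ r ℤ.+ r′ ∣) → NeverNeutral (L M r κ 1ℤ ⊗ L M r′ κ 1ℤ)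
neverNeutral-L M r r′ κ M∤ = neverNeutral λ (s , t) p → M∤ (divides ℤ.∣ s ℤ.+ t ∣ (begin
    ℤ.∣ r ℤ.+ r′ ∣
      ≡⟨ cong ℤ.∣_∣ (e M r r′ s t) ⟩
    ℤ.∣ 1ℤ ℤ.* (M ℤ.* s ℤ.+ r) ℤ.+ 1ℤ ℤ.* (M ℤ.* t ℤ.+ r′) ℤ.- (s ℤ.+ t) ℤ.* M ∣
      ≡⟨ cong (λ w → ℤ.∣ w ℤ.- (s ℤ.+ t) ℤ.* M ∣) p ⟩
    ℤ.∣ 0ℤ ℤ.- (s ℤ.+ t) ℤ.* M ∣
      ≡⟨ cong ℤ.∣_∣ (ℤ.+-identityˡ (ℤ.- ((s ℤ.+ t) ℤ.* M))) ⟩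
    ℤ.∣ ℤ.- ((s ℤ.+ t) ℤ.* M) ∣
      ≡⟨ ℤ.∣-i∣≡∣i∣ ((s ℤ.+ t) ℤ.* M) ⟩
    ℤ.∣ (s ℤ.+ t) ℤ.* M ∣
      ≡⟨ ℤ.abs-* (s ℤ.+ t) M ⟩
    ℤ.∣ s ℤ.+ t ∣ ℕ.* ℤ.∣ M ∣ ∎))
  where
  open ≡-Reasoning
  e : ∀ M r r′ s t → r ℤ.+ r′ ≡ 1ℤ ℤ.* (M ℤ.* s ℤ.+ r) ℤ.+ 1ℤ ℤ.* (M ℤ.* t ℤ.+ r′) ℤ.- (s ℤ.+ t) ℤ.* M
  e = ℤ-Solver.solve-∀

-- Charge 0 forces the second index to be opposite to the first, M being cancellable; the two
-- squares are then equal, which doubles κ.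
neutral-L : ∀ M .{{_ : ℤ.NonZero M}} r κ → L M r (κ ℤ.+ κ) 0ℤ ≅ neutral (L M r κ 1ℤ ⊗ L M (ℤ.- r) κ 1ℤ)
neutral-L M r κ = iso
  (mk↔ₛ′ (λ s → (s , ℤ.- s) , e₁ M r s) (λ ((s , _) , _) → s)
    (λ ((s , t) , p) → neutral-≡ (L M r κ 1ℤ ⊗ L M (ℤ.- r) κ 1ℤ) (cong (s ,_) (opposite s t p))) (λ _ → refl))
  (λ s → e₂ M r κ s) (λ s → e₁ M r s)
  where
  e₁ : ∀ M r s → 1ℤ ℤ.* (M ℤ.* s ℤ.+ r) ℤ.+ 1ℤ ℤ.* (M ℤ.* (ℤ.- s) ℤ.+ ℤ.- r) ≡ 0ℤ
  e₁ = ℤ-Solver.solve-∀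
  e₂ : ∀ M r κ s →
    κ ℤ.* ((M ℤ.* s ℤ.+ r) ℤ.* (M ℤ.* s ℤ.+ r))
      ℤ.+ κ ℤ.* ((M ℤ.* (ℤ.- s) ℤ.+ ℤ.- r) ℤ.* (M ℤ.* (ℤ.- s) ℤ.+ ℤ.- r))
    ≡ (κ ℤ.+ κ) ℤ.* ((M ℤ.* s ℤ.+ r) ℤ.* (M ℤ.* s ℤ.+ r))
  e₂ = ℤ-Solver.solve-∀
  e₃ : ∀ M r s t → M ℤ.* (ℤ.- s) ≡
    M ℤ.* t ℤ.- (1ℤ ℤ.* (M ℤ.* s ℤ.+ r) ℤ.+ 1ℤ ℤ.* (M ℤ.* t ℤ.+ ℤ.- r))
  e₃ = ℤ-Solver.solve-∀
  opposite : ∀ s t → 1ℤ ℤ.* (M ℤ.* s ℤ.+ r) ℤ.+ 1ℤ ℤ.* (M ℤ.* t ℤ.+ ℤ.- r) ≡ 0ℤ → ℤ.- s ≡ t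
  opposite s t p = ℤ.*-cancelˡ-≡ M (ℤ.- s) t
    (trans (e₃ M r s t) (trans (cong (λ w → M ℤ.* t ℤ.- w) p) (ℤ.+-identityʳ (M ℤ.* t))))

-- The constant term of θ(z)⁸

open ThetaPolynomial gset-semiring
open RawSemiring (CommutativeSemiring.rawSemiring gset-semiring) using (_^_; _×′_)

-- With weights 16 times the exponent of q these are ∑ z^m q^(m²/2), Θ₃(q⁴) and Θ₂(q⁴).
θ θ₃ θ₂ : GSet
θ = L 1ℤ 0ℤ (+ 8) 1ℤ
θ₃ = L (+ 8) 0ℤ 1ℤ 0ℤ
θ₂ = L (+ 8) (+ 4) 1ℤ 0ℤ

neutral-θ⁸ : neutral (θ ^ 8) ≅ thetaPolynomial θ₃ θ₂
neutral-θ⁸ = begin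
  neutral (θ ^ 8)
    ≈⟨ neutral-cong (eighth-power {P = P} {Q} {a₁} {b₁} {A} {B} {D} {E₀} {E₁} {E₂} {E₃} θ² P² Q² PQ) ⟩
  neutral ((c₀ ⊗ c₀) ⊗ (E₀ ⊗ E₀) ⊕ (c₂ ⊗ c₂) ⊗ (E₂ ⊗ E₂) ⊕ (c₁ ⊗ c₁ ⊕ c₁ ⊗ c₁) ⊗ (E₁ ⊗ E₃) ⊕ V)
    ≈⟨ ≅-trans (neutral-⊕ _ V) (⊕-cong (≅-trans (neutral-⊕ _ _) (⊕-cong (neutral-⊕ _ _) ≅-refl))
         (neutral-empty V-empty)) ⟩
  neutral ((c₀ ⊗ c₀) ⊗ (E₀ ⊗ E₀)) ⊕ neutral ((c₂ ⊗ c₂) ⊗ (E₂ ⊗ E₂)) ⊕ neutral ((c₁ ⊗ c₁ ⊕ c₁ ⊗ c₁) ⊗ (E₁ ⊗ E₃)) ⊕ 𝟘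
    ≈⟨ +-identityʳ _ ⟩
  neutral ((c₀ ⊗ c₀) ⊗ (E₀ ⊗ E₀)) ⊕ neutral ((c₂ ⊗ c₂) ⊗ (E₂ ⊗ E₂)) ⊕ neutral ((c₁ ⊗ c₁ ⊕ c₁ ⊗ c₁) ⊗ (E₁ ⊗ E₃))
    ≈⟨ ⊕-cong (⊕-cong (neutral-⊗ (E₀ ⊗ E₀) (uncharged-⊗ u₀ u₀)) (neutral-⊗ (E₂ ⊗ E₂) (uncharged-⊗ u₂ u₂)))
              (neutral-⊗ (E₁ ⊗ E₃) (uncharged-⊕ (uncharged-⊗ u₁ u₁) (uncharged-⊗ u₁ u₁))) ⟩
  (c₀ ⊗ c₀) ⊗ neutral (E₀ ⊗ E₀) ⊕ (c₂ ⊗ c₂) ⊗ neutral (E₂ ⊗ E₂) ⊕ (c₁ ⊗ c₁ ⊕ c₁ ⊗ c₁) ⊗ neutral (E₁ ⊗ E₃)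
    ≈⟨ ⊕-cong (⊕-cong (⊗-cong ≅-refl n₀₀) (⊗-cong ≅-refl n₂₂)) (⊗-cong ≅-refl n₁₃) ⟩
  (c₀ ⊗ c₀) ⊗ θ₃ ⊕ (c₂ ⊗ c₂) ⊗ θ₂ ⊕ (c₁ ⊗ c₁ ⊕ c₁ ⊗ c₁) ⊗ ψ
    ≈⟨ theta-polynomial {A = A} {B} {D} {ψ} {a₁} {b₁} a₁² b₁² A² B² D² a₁-split b₁-split ⟩
  thetaPolynomial θ₃ θ₂ ∎
  where
  open CommutativeSemiring gset-semiring using (setoid; +-identityʳ)
  open import Relation.Binary.Reasoning.Setoid setoid

  -- Here `a₁` = Θ₃(q), `b₁` = Θ₂(q), `A` = Θ₃(q²) and `B` = Θ₂(q²), while `ψ` and `D` are the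
  -- halves of Θ₂(q) and of Θ₂(q^(1/2)). `P` and `Q` sort the charge by its residue modulo 2, `E₀`
  -- to `E₃` modulo 4.
  P Q a₁ b₁ A B D ψ E₀ E₁ E₂ E₃ c₀ c₁ c₂ V : GSet
  P = L (+ 2) 0ℤ (+ 4) 1ℤ
  Q = L (+ 2) 1ℤ (+ 4) 1ℤ
  a₁ = L (+ 2) 0ℤ (+ 4) 0ℤ
  b₁ = L (+ 2) 1ℤ (+ 4) 0ℤ
  A = L (+ 4) 0ℤ (+ 2) 0ℤ
  B = L (+ 4) (+ 2) (+ 2) 0ℤ
  D = L (+ 4) 1ℤ (+ 2) 0ℤ
  ψ = L (+ 8) (+ 2) 1ℤ 0ℤ
  E₀ = L (+ 4) 0ℤ (+ 2) 1ℤ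
  E₁ = L (+ 4) 1ℤ (+ 2) 1ℤ
  E₂ = L (+ 4) (+ 2) (+ 2) 1ℤ
  E₃ = L (+ 4) (+ 3) (+ 2) 1ℤ
  c₀ = (a₁ ⊗ a₁) ⊗ A ⊕ (b₁ ⊗ b₁) ⊗ B
  c₁ = (a₁ ⊗ b₁ ⊕ a₁ ⊗ b₁) ⊗ D
  c₂ = (a₁ ⊗ a₁) ⊗ B ⊕ (b₁ ⊗ b₁) ⊗ A
  V = (c₀ ⊗ c₁ ⊕ c₀ ⊗ c₁) ⊗ (E₀ ⊗ E₁) ⊕ (c₀ ⊗ c₁ ⊕ c₀ ⊗ c₁) ⊗ (E₀ ⊗ E₃) ⊕ (c₀ ⊗ c₂ ⊕ c₀ ⊗ c₂) ⊗ (E₀ ⊗ E₂)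
    ⊕ (c₁ ⊗ c₁) ⊗ (E₁ ⊗ E₁) ⊕ (c₁ ⊗ c₁) ⊗ (E₃ ⊗ E₃)
    ⊕ (c₁ ⊗ c₂ ⊕ c₁ ⊗ c₂) ⊗ (E₁ ⊗ E₂) ⊕ (c₁ ⊗ c₂ ⊕ c₁ ⊗ c₂) ⊗ (E₂ ⊗ E₃)

  u₀ : Uncharged c₀
  u₀ = uncharged-⊕ (uncharged-⊗ (uncharged-⊗ uncharged-L uncharged-L) uncharged-L)
                  (uncharged-⊗ (uncharged-⊗ uncharged-L uncharged-L) uncharged-L)
  u₁ : Uncharged c₁
  u₁ = uncharged-⊗ (uncharged-⊕ (uncharged-⊗ uncharged-L uncharged-L) (uncharged-⊗ uncharged-L uncharged-L))
         uncharged-L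
  u₂ : Uncharged c₂
  u₂ = uncharged-⊕ (uncharged-⊗ (uncharged-⊗ uncharged-L uncharged-L) uncharged-L)
                  (uncharged-⊗ (uncharged-⊗ uncharged-L uncharged-L) uncharged-L)

  V-empty : NeverNeutral V
  V-empty =
    -- The sums of residues are 1, 3, 2, 2, 6, 3 and 5, none divisible by 4.
    neverNeutral-⊕ (neverNeutral-⊕ (neverNeutral-⊕ (neverNeutral-⊕ (neverNeutral-⊕ (neverNeutral-⊕
      (neverNeutral-⊗ (twice u₀ u₁) (neverNeutral-L (+ 4) 0ℤ 1ℤ (+ 2) (from-no (4 ∣? 1))))
      (neverNeutral-⊗ (twice u₀ u₁) (neverNeutral-L (+ 4) 0ℤ (+ 3) (+ 2) (from-no (4 ∣? 3)))))
      (neverNeutral-⊗ (twice u₀ u₂) (neverNeutral-L (+ 4) 0ℤ (+ 2) (+ 2) (from-no (4 ∣? 2)))))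
      (neverNeutral-⊗ (uncharged-⊗ u₁ u₁) (neverNeutral-L (+ 4) 1ℤ 1ℤ (+ 2) (from-no (4 ∣? 2)))))
      (neverNeutral-⊗ (uncharged-⊗ u₁ u₁) (neverNeutral-L (+ 4) (+ 3) (+ 3) (+ 2) (from-no (4 ∣? 6)))))
      (neverNeutral-⊗ (twice u₁ u₂) (neverNeutral-L (+ 4) 1ℤ (+ 2) (+ 2) (from-no (4 ∣? 3)))))
      (neverNeutral-⊗ (twice u₁ u₂) (neverNeutral-L (+ 4) (+ 2) (+ 3) (+ 2) (from-no (4 ∣? 5))))
    where
    twice : ∀ {X Y} → Uncharged X → Uncharged Y → Uncharged (X ⊗ Y ⊕ X ⊗ Y)
    twice u v = uncharged-⊕ (uncharged-⊗ u v) (uncharged-⊗ u v)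

  θ² : θ ⊗ θ ≅ P ⊗ a₁ ⊕ Q ⊗ b₁
  θ² = ≅-sym (L-pair 1ℤ 0ℤ 0ℤ (+ 4) 1ℤ)
  P² : P ⊗ P ≅ E₀ ⊗ A ⊕ E₂ ⊗ B
  P² = ≅-sym (L-pair (+ 2) 0ℤ 0ℤ (+ 2) 1ℤ)
  Q² : Q ⊗ Q ≅ E₂ ⊗ A ⊕ E₀ ⊗ B
  Q² = ≅-trans (≅-sym (L-pair (+ 2) 1ℤ 1ℤ (+ 2) 1ℤ))
    (⊕-cong ≅-refl (⊗-cong (L-shift (+ 4) 0ℤ (+ 2) 1ℤ) ≅-refl))
  PQ : P ⊗ Q ≅ E₁ ⊗ D ⊕ E₃ ⊗ D
  PQ = ≅-trans (≅-sym (L-pair (+ 2) 0ℤ 1ℤ (+ 2) 1ℤ))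
    (⊕-cong (⊗-cong ≅-refl (L-neg (+ 4) 1ℤ (+ 2))) ≅-refl)
  a₁² : a₁ ⊗ a₁ ≅ A ⊗ A ⊕ B ⊗ B
  a₁² = ≅-sym (L-pair (+ 2) 0ℤ 0ℤ (+ 2) 0ℤ)
  b₁² : b₁ ⊗ b₁ ≅ B ⊗ A ⊕ A ⊗ B
  b₁² = ≅-trans (≅-sym (L-pair (+ 2) 1ℤ 1ℤ (+ 2) 0ℤ))
    (⊕-cong ≅-refl (⊗-cong (L-shift (+ 4) 0ℤ (+ 2) 0ℤ) ≅-refl))
  A² : A ⊗ A ≅ θ₃ ⊗ θ₃ ⊕ θ₂ ⊗ θ₂
  A² = ≅-sym (L-pair (+ 4) 0ℤ 0ℤ 1ℤ 0ℤ)
  B² : B ⊗ B ≅ θ₂ ⊗ θ₃ ⊕ θ₃ ⊗ θ₂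
  B² = ≅-trans (≅-sym (L-pair (+ 4) (+ 2) (+ 2) 1ℤ 0ℤ))
    (⊕-cong ≅-refl (⊗-cong (L-shift (+ 8) 0ℤ 1ℤ 0ℤ) ≅-refl))
  -- Since 6 = 8 - 2, the classes 2 and 6 are exchanged by x ↦ -x; this is why Θ₂(q) is twice `ψ`.
  ψ-reflect : L (+ 8) (+ 6) 1ℤ 0ℤ ≅ ψ
  ψ-reflect = ≅-trans (L-shift (+ 8) (ℤ.- + 2) 1ℤ 0ℤ) (L-neg (+ 8) (+ 2) 1ℤ)
  D² : D ⊗ D ≅ ψ ⊗ θ₃ ⊕ ψ ⊗ θ₂
  D² = ≅-trans (≅-sym (L-pair (+ 4) 1ℤ 1ℤ 1ℤ 0ℤ)) (⊕-cong ≅-refl (⊗-cong ψ-reflect ≅-refl))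
  a₁-split : a₁ ≅ θ₃ ⊕ θ₂
  a₁-split = ≅-trans (≅-sym (L-split (+ 2) 0ℤ (+ 4) 0ℤ))
    (⊕-cong (≅-sym (L-rescale (+ 4) 0ℤ 1ℤ)) (≅-sym (L-rescale (+ 4) (+ 2) 1ℤ)))
  b₁-split : b₁ ≅ ψ ⊕ ψ
  b₁-split = ≅-trans (≅-sym (L-split (+ 2) 1ℤ (+ 4) 0ℤ))
    (⊕-cong (≅-sym (L-rescale (+ 4) 1ℤ 1ℤ)) (≅-trans (≅-sym (L-rescale (+ 4) (+ 3) 1ℤ)) ψ-reflect))
  n₀₀ : neutral (E₀ ⊗ E₀) ≅ θ₃
  n₀₀ = ≅-trans (≅-sym (neutral-L (+ 4) 0ℤ (+ 2))) (≅-sym (L-rescale (+ 4) 0ℤ 1ℤ))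
  n₂₂ : neutral (E₂ ⊗ E₂) ≅ θ₂
  -- The second residue 2 is read as 4 + (-2), so that the residues are opposite as `neutral-L`
  -- demands; for `n₁₃` it is 3 = 4 + (-1).
  n₂₂ = ≅-trans (neutral-cong (⊗-cong ≅-refl (L-shift (+ 4) (ℤ.- + 2) (+ 2) 1ℤ)))
    (≅-trans (≅-sym (neutral-L (+ 4) (+ 2) (+ 2))) (≅-sym (L-rescale (+ 4) (+ 2) 1ℤ)))
  n₁₃ : neutral (E₁ ⊗ E₃) ≅ ψ
  n₁₃ = ≅-trans (neutral-cong (⊗-cong ≅-refl (L-shift (+ 4) (ℤ.- + 1) (+ 2) 1ℤ)))
    (≅-trans (≅-sym (neutral-L (+ 4) 1ℤ (+ 2))) (≅-sym (L-rescale (+ 4) 1ℤ 1ℤ)))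

-- Formal power series

infix 4 _≈ₛ_

_≈ₛ_ : PS → PS → Set
f ≈ₛ g = ∀ n → f n ≡ g n

zeroₛ : PS
zeroₛ _ = 0ℤ

tailₛ : PS → PS
tailₛ f n = f (suc n)

sumRange-cong : ∀ n {f g : ℕ → ℤ} → (∀ i → i ≤ n → f i ≡ g i) → sumRange n f ≡ sumRange n g
sumRange-cong zero e = e 0 z≤n
sumRange-cong (suc n) e = cong₂ ℤ._+_ (sumRange-cong n (λ i i≤n → e i (ℕ.m≤n⇒m≤1+n i≤n))) (e (suc n) ℕ.≤-refl)

sumRange-suc : ∀ n f → sumRange (suc n) f ≡ f 0 ℤ.+ sumRange n (λ i → f (suc i))
sumRange-suc zero f = refl
sumRange-suc (suc n) f = trans (cong (ℤ._+ f (suc (suc n))) (sumRange-suc n f)) (ℤ.+-assoc (f 0) _ _)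

sumRange-+ : ∀ n f g → sumRange n (λ i → f i ℤ.+ g i) ≡ sumRange n f ℤ.+ sumRange n g
sumRange-+ zero f g = refl
sumRange-+ (suc n) f g = trans (cong (ℤ._+ (f (suc n) ℤ.+ g (suc n))) (sumRange-+ n f g))
  (interchange (sumRange n f) (sumRange n g) (f (suc n)) (g (suc n)))
  where
  interchange : ∀ a b c d → a ℤ.+ b ℤ.+ (c ℤ.+ d) ≡ a ℤ.+ c ℤ.+ (b ℤ.+ d)
  interchange = ℤ-Solver.solve-∀

sumRange-* : ∀ n c f → sumRange n (λ i → c ℤ.* f i) ≡ c ℤ.* sumRange n f
sumRange-* zero c f = refl
sumRange-* (suc n) c f = trans (cong (ℤ._+ c ℤ.* f (suc n)) (sumRange-* n c f))
  (sym (ℤ.*-distribˡ-+ c (sumRange n f) (f (suc n))))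

sumRange-0 : ∀ n → sumRange n (λ _ → 0ℤ) ≡ 0ℤ
sumRange-0 zero = refl
sumRange-0 (suc n) = trans (ℤ.+-identityʳ _) (sumRange-0 n)

*ₛ-agree : ∀ {f f′ g g′} n → (∀ i → i ≤ n → f i ≡ f′ i) → (∀ i → i ≤ n → g i ≡ g′ i) → (f *ₛ g) n ≡ (f′ *ₛ g′) n
*ₛ-agree n e e′ = sumRange-cong n (λ i i≤n → cong₂ ℤ._*_ (e i i≤n) (e′ (n ∸ i) (ℕ.m∸n≤m n i)))

*ₛ-cong : ∀ {f f′ g g′} → f ≈ₛ f′ → g ≈ₛ g′ → f *ₛ g ≈ₛ f′ *ₛ g′
*ₛ-cong e e′ n = *ₛ-agree n (λ i _ → e i) (λ i _ → e′ i)

*ₛ-suc : ∀ f g n → (f *ₛ g) (suc n) ≡ f 0 ℤ.* g (suc n) ℤ.+ (tailₛ f *ₛ g) n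
*ₛ-suc f g n = sumRange-suc n (λ i → f i ℤ.* g (suc n ∸ i))

*ₛ-sucʳ : ∀ f g n → (f *ₛ g) (suc n) ≡ (f *ₛ tailₛ g) n ℤ.+ f (suc n) ℤ.* g 0
*ₛ-sucʳ f g n = cong₂ ℤ._+_ (sumRange-cong n (λ i i≤n → cong (λ k → f i ℤ.* g k) (ℕ.+-∸-assoc 1 i≤n)))
  (cong (λ k → f (suc n) ℤ.* g k) (ℕ.n∸n≡0 n))

*ₛ-comm : ∀ f g → f *ₛ g ≈ₛ g *ₛ f
*ₛ-comm f g zero = ℤ.*-comm (f 0) (g 0)
*ₛ-comm f g (suc n) = begin
  (f *ₛ g) (suc n)                          ≡⟨ *ₛ-suc f g n ⟩
  f 0 ℤ.* g (suc n) ℤ.+ (tailₛ f *ₛ g) n    ≡⟨ cong₂ ℤ._+_ (ℤ.*-comm (f 0) (g (suc n))) (*ₛ-comm (tailₛ f) g n) ⟩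
  g (suc n) ℤ.* f 0 ℤ.+ (g *ₛ tailₛ f) n    ≡⟨ ℤ.+-comm (g (suc n) ℤ.* f 0) _ ⟩
  (g *ₛ tailₛ f) n ℤ.+ g (suc n) ℤ.* f 0    ≡⟨ *ₛ-sucʳ g f n ⟨
  (g *ₛ f) (suc n)                          ∎
  where open ≡-Reasoning

*ₛ-distribʳ : ∀ h f g → (f +ₛ g) *ₛ h ≈ₛ f *ₛ h +ₛ g *ₛ h
*ₛ-distribʳ h f g n = trans (sumRange-cong n (λ i _ → ℤ.*-distribʳ-+ (h (n ∸ i)) (f i) (g i)))
  (sumRange-+ n (λ i → f i ℤ.* h (n ∸ i)) (λ i → g i ℤ.* h (n ∸ i)))

·ₛ-*ₛ : ∀ c f g → (c ·ₛ f) *ₛ g ≈ₛ c ·ₛ (f *ₛ g)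
·ₛ-*ₛ c f g n = trans (sumRange-cong n (λ i _ → ℤ.*-assoc c (f i) (g (n ∸ i))))
  (sumRange-* n c (λ i → f i ℤ.* g (n ∸ i)))

*ₛ-zeroˡ : ∀ f → zeroₛ *ₛ f ≈ₛ zeroₛ
*ₛ-zeroˡ f n = sumRange-0 n

*ₛ-identityˡ : ∀ f → oneₛ *ₛ f ≈ₛ f
*ₛ-identityˡ f zero = ℤ.*-identityˡ (f 0)
*ₛ-identityˡ f (suc n) = trans (*ₛ-suc oneₛ f n)
  (trans (cong₂ ℤ._+_ (ℤ.*-identityˡ (f (suc n))) (*ₛ-zeroˡ f n)) (ℤ.+-identityʳ (f (suc n))))

*ₛ-assoc : ∀ f g h → (f *ₛ g) *ₛ h ≈ₛ f *ₛ (g *ₛ h)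
*ₛ-assoc f g h zero = ℤ.*-assoc (f 0) (g 0) (h 0)
*ₛ-assoc f g h (suc n) = begin
  ((f *ₛ g) *ₛ h) (suc n)
    ≡⟨ *ₛ-suc (f *ₛ g) h n ⟩
  a ℤ.* b ℤ.* c ℤ.+ (tailₛ (f *ₛ g) *ₛ h) n
    ≡⟨ cong (λ w → a ℤ.* b ℤ.* c ℤ.+ w) (trans (*ₛ-cong {g = h} (*ₛ-suc f g) (λ _ → refl) n)
         (*ₛ-distribʳ h (a ·ₛ tailₛ g) (tailₛ f *ₛ g) n)) ⟩
  a ℤ.* b ℤ.* c ℤ.+ (((a ·ₛ tailₛ g) *ₛ h) n ℤ.+ ((tailₛ f *ₛ g) *ₛ h) n)
    ≡⟨ cong₂ (λ u v → a ℤ.* b ℤ.* c ℤ.+ (u ℤ.+ v)) (·ₛ-*ₛ a (tailₛ g) h n) (*ₛ-assoc (tailₛ f) g h n) ⟩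
  a ℤ.* b ℤ.* c ℤ.+ (a ℤ.* (tailₛ g *ₛ h) n ℤ.+ (tailₛ f *ₛ (g *ₛ h)) n)
    ≡⟨ rearrange a b c ((tailₛ g *ₛ h) n) ((tailₛ f *ₛ (g *ₛ h)) n) ⟩
  a ℤ.* (b ℤ.* c ℤ.+ (tailₛ g *ₛ h) n) ℤ.+ (tailₛ f *ₛ (g *ₛ h)) n
    ≡⟨ cong (λ w → a ℤ.* w ℤ.+ (tailₛ f *ₛ (g *ₛ h)) n) (*ₛ-suc g h n) ⟨
  a ℤ.* (g *ₛ h) (suc n) ℤ.+ (tailₛ f *ₛ (g *ₛ h)) n
    ≡⟨ *ₛ-suc f (g *ₛ h) n ⟨
  (f *ₛ (g *ₛ h)) (suc n) ∎
  where
  open ≡-Reasoning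
  a b c : ℤ
  a = f 0
  b = g 0
  c = h (suc n)
  rearrange : ∀ a b c x y → a ℤ.* b ℤ.* c ℤ.+ (a ℤ.* x ℤ.+ y) ≡ a ℤ.* (b ℤ.* c ℤ.+ x) ℤ.+ y
  rearrange = ℤ-Solver.solve-∀

ps-semiring : CommutativeSemiring 0ℓ 0ℓ
ps-semiring = record
  { Carrier = PS
  ; _≈_ = _≈ₛ_
  ; _+_ = _+ₛ_
  ; _*_ = _*ₛ_
  ; 0# = zeroₛ
  ; 1# = oneₛ
  ; isCommutativeSemiring = Biased.isCommutativeSemiringˡ record
    { +-isCommutativeMonoid = Biased.isCommutativeMonoidˡ record
      { isSemigroup = record
        { isMagma = record { isEquivalence = equiv ; ∙-cong = λ e e′ n → cong₂ ℤ._+_ (e n) (e′ n) }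
        ; assoc = λ f g h n → ℤ.+-assoc (f n) (g n) (h n) }
      ; identityˡ = λ f n → ℤ.+-identityˡ (f n)
      ; comm = λ f g n → ℤ.+-comm (f n) (g n) }
    ; *-isCommutativeMonoid = Biased.isCommutativeMonoidˡ record
      { isSemigroup = record
        { isMagma = record { isEquivalence = equiv ; ∙-cong = *ₛ-cong }
        ; assoc = *ₛ-assoc }
      ; identityˡ = *ₛ-identityˡ
      ; comm = *ₛ-comm }
    ; distribʳ = *ₛ-distribʳ
    ; zeroˡ = *ₛ-zeroˡ
    }
  }
  where
  equiv : IsEquivalence _≈ₛ_
  equiv = record { refl = λ _ → refl ; sym = λ e n → sym (e n) ; trans = λ e e′ n → trans (e n) (e′ n) }

module PSR = CommutativeSemiring ps-semiring

-- Inverses, Euler's product and partitions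

invₛ-convolution : ∀ f n h →
  sumℤ (zipWith ℤ._*_ (applyUpTo h (suc n)) (toList (invRev f n))) ≡ sumRange n (λ i → h i ℤ.* invₛ f (n ∸ i))
invₛ-convolution f zero h = ℤ.+-identityʳ (h 0 ℤ.* 1ℤ)
invₛ-convolution f (suc n) h = trans
  -- The statement is made for arbitrary `h` because the induction replaces `h` by its shift.
  (cong (λ w → h 0 ℤ.* invₛ f (suc n) ℤ.+ w) (invₛ-convolution f n (λ i → h (suc i))))
  (sym (sumRange-suc n (λ i → h i ℤ.* invₛ f (suc n ∸ i))))

*ₛ-invʳ : ∀ f → f 0 ≡ 1ℤ → f *ₛ invₛ f ≈ₛ oneₛ
*ₛ-invʳ f f₀ zero = cong (ℤ._* 1ℤ) f₀
*ₛ-invʳ f f₀ (suc n) = begin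
  (f *ₛ invₛ f) (suc n)
    ≡⟨ *ₛ-suc f (invₛ f) n ⟩
  f 0 ℤ.* invₛ f (suc n) ℤ.+ (tailₛ f *ₛ invₛ f) n
    ≡⟨ cong (λ c → c ℤ.* invₛ f (suc n) ℤ.+ (tailₛ f *ₛ invₛ f) n) f₀ ⟩
  1ℤ ℤ.* invₛ f (suc n) ℤ.+ (tailₛ f *ₛ invₛ f) n
    ≡⟨ cong (λ w → 1ℤ ℤ.* ℤ.- w ℤ.+ (tailₛ f *ₛ invₛ f) n)
         (trans (cong (λ l → sumℤ (zipWith ℤ._*_ l (toList (invRev f n)))) (List.map-upTo (tailₛ f) (suc n)))
                (invₛ-convolution f n (tailₛ f))) ⟩
  1ℤ ℤ.* ℤ.- (tailₛ f *ₛ invₛ f) n ℤ.+ (tailₛ f *ₛ invₛ f) n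
    ≡⟨ cancel ((tailₛ f *ₛ invₛ f) n) ⟩
  0ℤ ∎
  where
  open ≡-Reasoning
  cancel : ∀ x → 1ℤ ℤ.* ℤ.- x ℤ.+ x ≡ 0ℤ
  cancel = ℤ-Solver.solve-∀

invₛ-unique : ∀ f p → f 0 ≡ 1ℤ → p *ₛ f ≈ₛ oneₛ → p ≈ₛ invₛ f
invₛ-unique f p f₀ e = begin
  p                   ≈⟨ PSR.*-identityʳ p ⟨
  p *ₛ oneₛ           ≈⟨ PSR.*-congˡ {p} (*ₛ-invʳ f f₀) ⟨
  p *ₛ (f *ₛ invₛ f)  ≈⟨ *ₛ-assoc p f (invₛ f) ⟨
  (p *ₛ f) *ₛ invₛ f  ≈⟨ PSR.*-congʳ {invₛ f} e ⟩
  oneₛ *ₛ invₛ f      ≈⟨ *ₛ-identityˡ (invₛ f) ⟩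
  invₛ f              ∎
  where open import Relation.Binary.Reasoning.Setoid PSR.setoid

monomialₛ : ℕ → PS
monomialₛ j n = if ⌊ n ℕ.≟ j ⌋ then 1ℤ else 0ℤ

monomialₛ-suc : ∀ j → tailₛ (monomialₛ (suc j)) ≈ₛ monomialₛ j
monomialₛ-suc j n with n ℕ.≟ j | suc n ℕ.≟ suc j
... | yes _ | yes _ = refl
... | no _  | no _  = refl
... | yes p | no q  = contradiction (cong suc p) q
... | no p  | yes q = contradiction (ℕ.suc-injective q) p

monomialₛ-*-≥ : ∀ j f n → (monomialₛ j *ₛ f) (j ℕ.+ n) ≡ f n
monomialₛ-*-≥ zero f n = trans
  (*ₛ-cong {monomialₛ 0} {oneₛ} {f} (λ { zero → refl ; (suc _) → refl }) (λ _ → refl) n) (*ₛ-identityˡ f n)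
monomialₛ-*-≥ (suc j) f n = begin
  (monomialₛ (suc j) *ₛ f) (suc (j ℕ.+ n))
    ≡⟨ *ₛ-suc (monomialₛ (suc j)) f (j ℕ.+ n) ⟩
  0ℤ ℤ.+ (tailₛ (monomialₛ (suc j)) *ₛ f) (j ℕ.+ n)
    ≡⟨ ℤ.+-identityˡ _ ⟩
  (tailₛ (monomialₛ (suc j)) *ₛ f) (j ℕ.+ n)
    ≡⟨ *ₛ-cong {g = f} (monomialₛ-suc j) (λ _ → refl) (j ℕ.+ n) ⟩
  (monomialₛ j *ₛ f) (j ℕ.+ n)
    ≡⟨ monomialₛ-*-≥ j f n ⟩
  f n ∎
  where open ≡-Reasoning

monomialₛ-*-< : ∀ j f n → n < j → (monomialₛ j *ₛ f) n ≡ 0ℤ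
monomialₛ-*-< (suc j) f zero _ = refl
monomialₛ-*-< (suc j) f (suc n) (s≤s n<j) = begin
  (monomialₛ (suc j) *ₛ f) (suc n)
    ≡⟨ *ₛ-suc (monomialₛ (suc j)) f n ⟩
  0ℤ ℤ.+ (tailₛ (monomialₛ (suc j)) *ₛ f) n
    ≡⟨ ℤ.+-identityˡ _ ⟩
  (tailₛ (monomialₛ (suc j)) *ₛ f) n
    ≡⟨ *ₛ-cong {g = f} (monomialₛ-suc j) (λ _ → refl) n ⟩
  (monomialₛ j *ₛ f) n
    ≡⟨ monomialₛ-*-< j f n n<j ⟩
  0ℤ ∎
  where open ≡-Reasoning

oneMinusQ^-+-monomialₛ : ∀ j → oneMinusQ^ (suc j) +ₛ monomialₛ (suc j) ≈ₛ oneₛ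
oneMinusQ^-+-monomialₛ j zero = refl
oneMinusQ^-+-monomialₛ j (suc n) with suc n ℕ.≟ suc j
... | yes _ = refl
... | no _  = refl

-- The expansion of 1/(1 - q^j) for j ≥ 1.
geometricₛ : ℕ → PS
geometricₛ j n = if ⌊ j ∣? n ⌋ then 1ℤ else 0ℤ

geometricₛ-periodic : ∀ j n → geometricₛ j (j ℕ.+ n) ≡ geometricₛ j n
geometricₛ-periodic j n with j ∣? (j ℕ.+ n) | j ∣? n
... | yes _ | yes _ = refl
... | no _  | no _  = refl
... | yes p | no q  = contradiction (∣m+n∣m⇒∣n p ∣-refl) q
... | no p  | yes q = contradiction (∣m∣n⇒∣m+n ∣-refl q) p

geometricₛ-agree : ∀ j n → n ≤ j → geometricₛ (suc j) n ≡ oneₛ n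
geometricₛ-agree j zero _ with suc j ∣? 0
... | yes _ = refl
... | no p  = contradiction (suc j ∣0) p
geometricₛ-agree j (suc n) n<j with suc j ∣? suc n
... | yes p = contradiction (∣⇒≤ p) (ℕ.<⇒≱ (s≤s n<j))
... | no _  = refl

-- Below the exponent j + 1 only the constant term survives on either side; from there on it is the
-- periodicity of divisibility.
geometricₛ-unfold : ∀ j → geometricₛ (suc j) ≈ₛ oneₛ +ₛ monomialₛ (suc j) *ₛ geometricₛ (suc j)
geometricₛ-unfold j n with n ℕ.≤? j
... | yes n≤j = trans (geometricₛ-agree j n n≤j) (sym (trans
        (cong (λ w → oneₛ n ℤ.+ w) (monomialₛ-*-< (suc j) (geometricₛ (suc j)) n (s≤s n≤j))) (ℤ.+-identityʳ (oneₛ n))))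
... | no n≰j = subst (λ k → geometricₛ (suc j) k ≡ (oneₛ +ₛ monomialₛ (suc j) *ₛ geometricₛ (suc j)) k)
        (ℕ.m+[n∸m]≡n (ℕ.≰⇒> n≰j)) (trans (geometricₛ-periodic (suc j) m)
          (sym (trans (ℤ.+-identityˡ _) (monomialₛ-*-≥ (suc j) (geometricₛ (suc j)) m))))
  where
  m : ℕ
  m = n ∸ suc j

-- The semiring has no subtraction, so G q^(j+1) is added to both sides and cancelled in each
-- coefficient.
geometricₛ-inverse : ∀ j → geometricₛ (suc j) *ₛ oneMinusQ^ (suc j) ≈ₛ oneₛ
geometricₛ-inverse j n = ∙-cancelʳ ((G *ₛ M) n) _ _ (begin
  (G *ₛ oneMinusQ^ (suc j) +ₛ G *ₛ M) n  ≡⟨ PSR.distribˡ G (oneMinusQ^ (suc j)) M n ⟨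
  (G *ₛ (oneMinusQ^ (suc j) +ₛ M)) n     ≡⟨ PSR.*-congˡ {G} (oneMinusQ^-+-monomialₛ j) n ⟩
  (G *ₛ oneₛ) n                          ≡⟨ PSR.*-identityʳ G n ⟩
  G n                                    ≡⟨ geometricₛ-unfold j n ⟩
  (oneₛ +ₛ M *ₛ G) n                     ≡⟨ cong (λ w → oneₛ n ℤ.+ w) (*ₛ-comm M G n) ⟩
  (oneₛ +ₛ G *ₛ M) n                     ∎)
  where
  open ≡-Reasoning
  open import Algebra.Properties.AbelianGroup ℤ.+-0-abelianGroup using (∙-cancelʳ)
  G M : PS
  G = geometricₛ (suc j)
  M = monomialₛ (suc j)

finEuler-suc : ∀ N → finEuler (suc N) ≈ₛ finEuler N *ₛ oneMinusQ^ (suc N)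
finEuler-suc N n = trans (cong (λ l → foldr step oneₛ l n) (sym (List.upTo-∷ʳ N))) (snoc (upTo N) n)
  where
  step : ℕ → PS → PS
  step i acc = oneMinusQ^ (suc i) *ₛ acc
  snoc : ∀ l → foldr step oneₛ (l ∷ʳ N) ≈ₛ foldr step oneₛ l *ₛ oneMinusQ^ (suc N)
  snoc [] = *ₛ-comm (oneMinusQ^ (suc N)) oneₛ
  snoc (i ∷ l) n = trans (PSR.*-congˡ {oneMinusQ^ (suc i)} (snoc l) n)
    (sym (*ₛ-assoc (oneMinusQ^ (suc i)) (foldr step oneₛ l) (oneMinusQ^ (suc N)) n))

-- The product of 1/(1 - q^j) over 1 ≤ j ≤ m, counting partitions into parts of size at most m.
partsₛ : ℕ → PS
partsₛ zero = oneₛ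
partsₛ (suc m) = partsₛ m *ₛ geometricₛ (suc m)

partsₛ-inverse : ∀ m → partsₛ m *ₛ finEuler m ≈ₛ oneₛ
partsₛ-inverse zero = *ₛ-identityˡ oneₛ
partsₛ-inverse (suc m) = begin
  (P *ₛ G) *ₛ finEuler (suc m)  ≈⟨ PSR.*-congˡ {P *ₛ G} (finEuler-suc m) ⟩
  (P *ₛ G) *ₛ (E *ₛ O)          ≈⟨ interchange P G E O ⟩
  (P *ₛ E) *ₛ (G *ₛ O)          ≈⟨ *ₛ-cong (partsₛ-inverse m) (geometricₛ-inverse m) ⟩
  oneₛ *ₛ oneₛ                  ≈⟨ *ₛ-identityˡ oneₛ ⟩
  oneₛ                          ∎
  where
  open import Relation.Binary.Reasoning.Setoid PSR.setoid
  open import Algebra.Properties.CommutativeSemigroup PSR.*-commutativeSemigroup using (interchange)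
  P G E O : PS
  P = partsₛ m
  G = geometricₛ (suc m)
  E = finEuler m
  O = oneMinusQ^ (suc m)

*ₛ-agree-one : ∀ f g n → (∀ i → i ≤ n → g i ≡ oneₛ i) → (f *ₛ g) n ≡ f n
*ₛ-agree-one f g n e = trans (*ₛ-agree {f} n (λ _ _ → refl) e) (PSR.*-identityʳ f n)

stable : ∀ (f : ℕ → PS) → (∀ N n → n ≤ N → f (suc N) n ≡ f N n) → ∀ {n N} → n ≤ N → f N n ≡ f n n
stable f s {n} n≤N = go (ℕ.≤⇒≤′ n≤N)
  where
  go : ∀ {N} → n ℕ.≤′ N → f N n ≡ f n n
  go ℕ.≤′-refl = refl
  go (ℕ.≤′-step {N} d) = trans (s N n (ℕ.≤′⇒≤ d)) (go d)

oneMinusQ^-agree : ∀ j n → n ≤ j → oneMinusQ^ (suc j) n ≡ oneₛ n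
oneMinusQ^-agree j zero _ = refl
oneMinusQ^-agree j (suc n) n<j with suc n ℕ.≟ suc j
... | yes p = contradiction n<j (ℕ.<⇒≱ (ℕ.≤-reflexive (sym p)))
... | no _  = refl

finEuler-stable : ∀ {n N} → n ≤ N → finEuler N n ≡ qqInf n
finEuler-stable = stable finEuler λ N n n≤N → trans (finEuler-suc N n)
  (*ₛ-agree-one (finEuler N) (oneMinusQ^ (suc N)) n (λ i i≤n → oneMinusQ^-agree N i (ℕ.≤-trans i≤n n≤N)))

-- The diagonal, in the manner of `qqInf`: a partition of n has no part larger than n.
partitionsₛ : PS
partitionsₛ n = partsₛ n n

partsₛ-stable : ∀ {n N} → n ≤ N → partsₛ N n ≡ partitionsₛ n
partsₛ-stable = stable partsₛ λ N n n≤N →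
  *ₛ-agree-one (partsₛ N) (geometricₛ (suc N)) n (λ i i≤n → geometricₛ-agree N i (ℕ.≤-trans i≤n n≤N))

-- Coefficient n of a product involves only coefficients up to n, and up to there both infinite
-- products agree with the finite ones for n.
partitionsₛ-inverse : partitionsₛ *ₛ qqInf ≈ₛ oneₛ
partitionsₛ-inverse n = trans
  (*ₛ-agree n (λ i i≤n → sym (partsₛ-stable i≤n)) (λ i i≤n → sym (finEuler-stable i≤n))) (partsₛ-inverse n n)

^ₛ-* : ∀ f g n → (f *ₛ g) ^ₛ n ≈ₛ f ^ₛ n *ₛ g ^ₛ n
^ₛ-* f g zero = PSR.sym {oneₛ *ₛ oneₛ} {oneₛ} (*ₛ-identityˡ oneₛ)
^ₛ-* f g (suc n) m = trans (PSR.*-congˡ {f *ₛ g} (^ₛ-* f g n) m) (interchange f g (f ^ₛ n) (g ^ₛ n) m)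
  where open import Algebra.Properties.CommutativeSemigroup PSR.*-commutativeSemigroup using (interchange)

^ₛ-cong : ∀ {f g} n → f ≈ₛ g → f ^ₛ n ≈ₛ g ^ₛ n
^ₛ-cong zero e _ = refl
^ₛ-cong (suc n) e = *ₛ-cong e (^ₛ-cong n e)

oneₛ-^ₛ : ∀ n → oneₛ ^ₛ n ≈ₛ oneₛ
oneₛ-^ₛ zero _ = refl
oneₛ-^ₛ (suc n) m = trans (*ₛ-identityˡ (oneₛ ^ₛ n) m) (oneₛ-^ₛ n m)

partitionsₛ⁸ : partitionsₛ ^ₛ 8 ≈ₛ invₛ (qqInf ^ₛ 8)
partitionsₛ⁸ = invₛ-unique (qqInf ^ₛ 8) (partitionsₛ ^ₛ 8) refl (λ n →
  trans (sym (^ₛ-* partitionsₛ qqInf 8 n)) (trans (^ₛ-cong 8 partitionsₛ-inverse n) (oneₛ-^ₛ 8 n)))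

-- Counting

-- The shape of the final claim: coefficients are integers, cardinalities are naturals, so each
-- count also certifies that the coefficient is not negative.
Sized : Set → ℤ → Set
Sized A z = Σ ℕ (λ m → (z ≡ + m) × HasCardinality A m)

sized-↔ : ∀ {A B z} → A ↔ B → Sized A z → Sized B z
sized-↔ i (m , e , b) = m , e , ↔.↔-trans (↔.↔-sym i) b

sized-⊎ : ∀ {A B y z} → Sized A y → Sized B z → Sized (A ⊎ B) (y ℤ.+ z)
sized-⊎ (m , e , b) (n , e′ , b′) = m ℕ.+ n , cong₂ ℤ._+_ e e′ , ↔.↔-trans (⊎-cong b b′) (↔.↔-sym Fin.+↔⊎)

sized-× : ∀ {A B y z} → Sized A y → Sized B z → Sized (A × B) (y ℤ.* z)
sized-× (m , e , b) (n , e′ , b′) =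
  m ℕ.* n , trans (cong₂ ℤ._*_ e e′) (sym (ℤ.pos-* m n)) , ↔.↔-trans (×-cong b b′) (↔.↔-sym Fin.*↔×)

sized-empty : ∀ {A} → ¬ A → Sized A 0ℤ
sized-empty ¬a = 0 , refl , mk↔ₛ′ (λ a → contradiction a ¬a) (λ ()) (λ ()) (λ a → contradiction a ¬a)

sized-singleton : ∀ {A} (a : A) → (∀ x → a ≡ x) → Sized A 1ℤ
sized-singleton a e = 1 , refl , mk↔ₛ′ (λ _ → Fin.zero) (λ _ → a) (λ { Fin.zero → refl ; (Fin.suc ()) }) e

sized-dec : ∀ {A P : Set} (d : Dec P) → (P → A) → (A → P) → (∀ (x y : A) → x ≡ y) →
  Sized A (if ⌊ d ⌋ then 1ℤ else 0ℤ)
sized-dec (yes p) f g prop = sized-singleton (f p) (prop (f p))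
sized-dec (no ¬p) f g prop = sized-empty (λ a → ¬p (g a))

sized-sum : ∀ {B : ℕ → Set} {f : ℕ → ℤ} → (∀ i → Sized (B i) (f i)) → ∀ n →
  Sized (Σ ℕ (λ i → i < n × B i)) (sumℤ (applyUpTo f n))
sized-sum s zero = sized-empty λ ()
sized-sum {B} s (suc n) = sized-↔
  (mk↔ₛ′ (λ { (inj₁ b) → 0 , s≤s z≤n , b ; (inj₂ (i , i<n , b)) → suc i , s≤s i<n , b })
         (λ { (zero , _ , b) → inj₁ b ; (suc i , s≤s i<n , b) → inj₂ (i , i<n , b) })
         (λ { (zero , s≤s z≤n , b) → refl ; (suc i , s≤s i<n , b) → refl })
         (λ { (inj₁ _) → refl ; (inj₂ _) → refl }))
  (sized-⊎ (s 0) (sized-sum (λ i → s (suc i)) n))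

sumRange-sumℤ : ∀ n f → sumRange n f ≡ sumℤ (applyUpTo f (suc n))
sumRange-sumℤ zero f = sym (ℤ.+-identityʳ (f 0))
sumRange-sumℤ (suc n) f = trans (sumRange-suc n f) (cong (λ w → f 0 ℤ.+ w) (sumRange-sumℤ n (λ i → f (suc i))))

Fibre : ∀ {A : Set} → (A → ℕ) → ℕ → Set
Fibre {A} d n = Σ A (λ x → d x ≡ n)

fibre-≡ : ∀ {A : Set} (d : A → ℕ) {n} {x y : A} {p : d x ≡ n} {q : d y ≡ n} → x ≡ y →
  _≡_ {A = Fibre d n} (x , p) (y , q)
fibre-≡ d {p = p} {q} refl = cong (_ ,_) (ℕ.≡-irrelevant p q)

fibre-↔ : ∀ {A B : Set} (i : A ↔ B) (d : A → ℕ) (d′ : B → ℕ) → (∀ x → d x ≡ d′ (Inverse.to i x)) →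
  ∀ {n} → Fibre d n ↔ Fibre d′ n
fibre-↔ i d d′ e = mk↔ₛ′ (λ (x , p) → I.to x , trans (sym (e x)) p)
  (λ (y , p) → I.from y , trans (e (I.from y)) (trans (cong d′ (I.strictlyInverseˡ y)) p))
  (λ (y , _) → fibre-≡ d′ (I.strictlyInverseˡ y)) (λ (x , _) → fibre-≡ d (I.strictlyInverseʳ x))
  where module I = Inverse i

-- The degree is a separate field because weights in general are not multiples of 16; only a series
-- in integral powers of q can satisfy this.
record Counts (X : GSet) (f : PS) : Set where
  constructor counts
  field
    deg    : Carrier X → ℕ
    wt-deg : ∀ x → wt X x ≡ + (16 ℕ.* deg x)
    sized  : ∀ n → Sized (Fibre deg n) (f n)

counts-cong : ∀ {X Y f g} → X ≅ Y → f ≈ₛ g → Counts X f → Counts Y g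
counts-cong i e (counts d w s) = counts
  (λ y → d (I.from y))
  (λ y → trans (sym (wt-eq (≅-sym i) y)) (w (I.from y)))
  (λ n → subst (Sized _) (e n)
    (sized-↔ (fibre-↔ (bij i) d (λ y → d (I.from y)) (λ x → cong d (sym (I.strictlyInverseʳ x)))) (s n)))
  where module I = Inverse (bij i)

counts-𝟘 : Counts 𝟘 zeroₛ
counts-𝟘 = counts (λ ()) (λ ()) (λ n → sized-empty λ ())

counts-𝟙 : Counts 𝟙 oneₛ
counts-𝟙 = counts (λ _ → 0) (λ _ → refl)
  (λ { zero → sized-singleton (tt , refl) (λ _ → fibre-≡ _ refl) ; (suc n) → sized-empty λ () })

counts-⊕ : ∀ {X Y f g} → Counts X f → Counts Y g → Counts (X ⊕ Y) (f +ₛ g)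
counts-⊕ (counts d w s) (counts d′ w′ s′) = counts
  (λ { (inj₁ x) → d x ; (inj₂ y) → d′ y })
  (λ { (inj₁ x) → w x ; (inj₂ y) → w′ y })
  (λ n → sized-↔
    (mk↔ₛ′ (λ { (inj₁ (x , p)) → inj₁ x , p ; (inj₂ (y , p)) → inj₂ y , p })
           (λ { (inj₁ x , p) → inj₁ (x , p) ; (inj₂ y , p) → inj₂ (y , p) })
           (λ { (inj₁ _ , _) → refl ; (inj₂ _ , _) → refl })
           (λ { (inj₁ _) → refl ; (inj₂ _) → refl }))
    (sized-⊎ (s n) (s′ n)))

-- The Cauchy product: pairs of total degree n are sorted by the degree i ≤ n of the first
-- component.
counts-⊗ : ∀ {X Y f g} → Counts X f → Counts Y g → Counts (X ⊗ Y) (f *ₛ g)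
counts-⊗ {X} {Y} {f} {g} (counts d w s) (counts d′ w′ s′) = counts
  d⊗
  (λ (x , y) → trans (cong₂ ℤ._+_ (w x) (w′ y)) (cong +_ (sym (ℕ.*-distribˡ-+ 16 (d x) (d′ y)))))
  (λ n → subst (Sized _) (sym (sumRange-sumℤ n (λ i → f i ℤ.* g (n ∸ i)))) (sized-↔
    (mk↔ₛ′ (join n) (split n)
      (λ _ → fibre-≡ d⊗ refl)
      (split-join n))
    (sized-sum (λ i → sized-× (s i) (s′ (n ∸ i))) (suc n))))
  where
  d⊗ : Carrier X × Carrier Y → ℕ
  d⊗ (x , y) = d x ℕ.+ d′ y
  join : ∀ n → Σ ℕ (λ i → i < suc n × Fibre d i × Fibre d′ (n ∸ i)) → Fibre d⊗ n
  join n (i , s≤s i≤n , (x , p) , (y , q)) = (x , y) , trans (cong₂ ℕ._+_ p q) (ℕ.m+[n∸m]≡n i≤n)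
  split : ∀ n → Fibre d⊗ n → Σ ℕ (λ i → i < suc n × Fibre d i × Fibre d′ (n ∸ i))
  split n ((x , y) , p) = d x , s≤s (ℕ.≤-trans (ℕ.m≤m+n (d x) (d′ y)) (ℕ.≤-reflexive p)) , (x , refl) ,
    (y , trans (sym (ℕ.m+n∸m≡n (d x) (d′ y))) (cong (_∸ d x) p))
  split-join : ∀ n z → split n (join n z) ≡ z
  split-join n (_ , s≤s i≤n , (x , refl) , (y , q)) =
    cong₂ (λ l z → d x , l , (x , refl) , z) (ℕ.<-irrelevant _ _) (fibre-≡ d′ refl)


counts-^ : ∀ {X f} → Counts X f → ∀ n → Counts (X ^ n) (f ^ₛ n)
counts-^ c zero = counts-𝟙
counts-^ c (suc n) = counts-⊗ c (counts-^ c n)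

-- The three clauses follow `×′`, which has no trailing zero: its multiple by 1 is the element
-- itself, and further summands are added on the right.
counts-×′ : ∀ n → Counts (n ×′ 𝟙) (+ n ·ₛ oneₛ)
counts-×′ zero = counts-cong ≅-refl (λ _ → refl) counts-𝟘
counts-×′ (suc zero) = counts-cong ≅-refl (λ n → sym (ℤ.*-identityˡ (oneₛ n))) counts-𝟙
counts-×′ (suc (suc m)) = counts-cong ≅-refl
  (λ n → trans (ℤ.+-comm (+ suc m ℤ.* oneₛ n) (oneₛ n)) (sym (ℤ.suc-* (+ suc m) (oneₛ n))))
  (counts-⊕ (counts-×′ (suc m)) counts-𝟙)

counts-multiple : ∀ n {X f} → Counts X f → Counts ((n ×′ 𝟙) ⊗ X) (+ n ·ₛ f)
counts-multiple n {f = f} c = counts-cong ≅-refl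
  (λ k → trans (·ₛ-*ₛ (+ n) oneₛ f k) (cong (+ n ℤ.*_) (*ₛ-identityˡ f k)))
  (counts-⊗ (counts-×′ n) c)

-- The theta functions as counts

intRange-surjective : ∀ n j → ℤ.∣ j ∣ ≤ n → Σ ℕ (λ i → i < suc (2 ℕ.* n) × + i ℤ.- + n ≡ j)
intRange-surjective n (+ m) m≤n = m ℕ.+ n ,
  s≤s (ℕ.≤-trans (ℕ.+-monoˡ-≤ n m≤n) (ℕ.≤-reflexive (cong (n ℕ.+_) (sym (ℕ.+-identityʳ n))))) , e (+ m) (+ n)
  where
  e : ∀ i j → i ℤ.+ j ℤ.- j ≡ i
  e = ℤ-Solver.solve-∀
intRange-surjective n -[1+ m ] m<n = n ∸ suc m , s≤s (ℕ.≤-trans (ℕ.m∸n≤m n (suc m)) (ℕ.m≤m+n n _)) ,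
  trans (cong (λ k → + (n ∸ suc m) ℤ.- + k) (sym (ℕ.m+[n∸m]≡n m<n))) (e (+ suc m) (+ (n ∸ suc m)))
  where
  e : ∀ i j → j ℤ.- (i ℤ.+ j) ≡ ℤ.- i
  e = ℤ-Solver.solve-∀

-- `countInt e n` only inspects |j| ≤ n. This loses nothing, since an index of degree n satisfies
-- |j| ≤ d j = n.
sized-countInt : ∀ (e : ℤ → ℤ) (d : ℤ → ℕ) → (∀ j → e j ≡ + d j) → (∀ j → ℤ.∣ j ∣ ≤ d j) →
  ∀ n → Sized (Fibre d n) (countInt e n)
sized-countInt e d e≡ bound n = subst (Sized (Fibre d n)) (sym count-≡) (sized-↔ preimages (sized-sum point N))
  where
  N : ℕ
  N = suc (2 ℕ.* n)
  h : ℕ → ℤ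
  h i = + i ℤ.- + n
  ind : ℤ → ℤ
  ind j = if ⌊ e j ℤ.≟ + n ⌋ then 1ℤ else 0ℤ
  count-≡ : countInt e n ≡ sumℤ (applyUpTo (λ i → ind (h i)) N)
  count-≡ = cong sumℤ (trans (cong (List.map ind) (List.map-upTo h N)) (List.map-applyUpTo h ind N))
  point : ∀ i → Sized (d (h i) ≡ n) (ind (h i))
  point i = sized-dec (e (h i) ℤ.≟ + n) (λ p → ℤ.+-injective (trans (sym (e≡ (h i))) p))
    (λ p → trans (e≡ (h i)) (cong +_ p)) ℕ.≡-irrelevant
  h-injective : ∀ {i j} → h i ≡ h j → i ≡ j
  h-injective {i} {j} p = ℤ.+-injective (∙-cancelʳ (ℤ.- + n) (+ i) (+ j) p)
    where open import Algebra.Properties.AbelianGroup ℤ.+-0-abelianGroup using (∙-cancelʳ)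
  preimage : ∀ j → d j ≡ n → Σ ℕ (λ i → i < N × h i ≡ j)
  preimage j p = intRange-surjective n j (ℕ.≤-trans (bound j) (ℕ.≤-reflexive p))
  B : Set
  B = Σ ℕ (λ i → i < N × d (h i) ≡ n)
  B-≡ : ∀ {x y : B} → proj₁ x ≡ proj₁ y → x ≡ y
  B-≡ {_ , l , p} {_ , l′ , q} refl = cong (_ ,_) (cong₂ _,_ (ℕ.<-irrelevant l l′) (ℕ.≡-irrelevant p q))
  from : Fibre d n → B
  from (j , p) = let (i , l , q) = preimage j p in i , l , trans (cong d q) p
  preimages : B ↔ Fibre d n
  preimages = mk↔ₛ′ (λ (i , _ , p) → h i , p) from
    (λ (j , p) → fibre-≡ d (proj₂ (proj₂ (preimage j p))))
    (λ (i , _ , p) → B-≡ (h-injective (proj₂ (proj₂ (preimage (h i) p)))))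

∣i∣*∣i∣ : ∀ i → i ℤ.* i ≡ + (ℤ.∣ i ∣ ℕ.* ℤ.∣ i ∣)
∣i∣*∣i∣ (+ n) = sym (ℤ.pos-* n n)
∣i∣*∣i∣ -[1+ n ] = refl

m≤m*m : ∀ m → m ≤ m ℕ.* m
m≤m*m zero = z≤n
m≤m*m (suc m) = ℕ.m≤m*n (suc m) (suc m)

counts-θ₃ : Counts θ₃ theta3q4
counts-θ₃ = counts d
  (λ j → trans (e₁ j) (trans (cong (+ 16 ℤ.*_) (e≡ j)) (sym (ℤ.pos-* 16 (d j)))))
  (sized-countInt _ d e≡ (λ j → ℕ.≤-trans (m≤m*m ℤ.∣ j ∣) (ℕ.m≤m+n _ _)))
  where
  d : ℤ → ℕ
  d j = 4 ℕ.* (ℤ.∣ j ∣ ℕ.* ℤ.∣ j ∣)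
  e≡ : ∀ j → + 4 ℤ.* (j ℤ.* j) ≡ + d j
  e≡ j = trans (cong (+ 4 ℤ.*_) (∣i∣*∣i∣ j)) (sym (ℤ.pos-* 4 (ℤ.∣ j ∣ ℕ.* ℤ.∣ j ∣)))
  e₁ : ∀ j → 1ℤ ℤ.* ((+ 8 ℤ.* j ℤ.+ 0ℤ) ℤ.* (+ 8 ℤ.* j ℤ.+ 0ℤ)) ≡ + 16 ℤ.* (+ 4 ℤ.* (j ℤ.* j))
  e₁ = ℤ-Solver.solve-∀

counts-θ₂ : Counts θ₂ theta2q4
counts-θ₂ = counts d
  (λ j → trans (e₁ j) (trans (cong (+ 16 ℤ.*_) (∣i∣*∣i∣ (odd j))) (sym (ℤ.pos-* 16 (d j)))))
  (sized-countInt _ d (λ j → ∣i∣*∣i∣ (odd j)) (λ j → ℕ.≤-trans (∣j∣≤ j) (m≤m*m ℤ.∣ odd j ∣)))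
  where
  odd : ℤ → ℤ
  odd j = + 2 ℤ.* j ℤ.+ 1ℤ
  d : ℤ → ℕ
  d j = ℤ.∣ odd j ∣ ℕ.* ℤ.∣ odd j ∣
  e₁ : ∀ j → 1ℤ ℤ.* ((+ 8 ℤ.* j ℤ.+ + 4) ℤ.* (+ 8 ℤ.* j ℤ.+ + 4)) ≡ + 16 ℤ.* ((+ 2 ℤ.* j ℤ.+ 1ℤ) ℤ.* (+ 2 ℤ.* j ℤ.+ 1ℤ))
  e₁ = ℤ-Solver.solve-∀
  e₂ : ∀ j → + 2 ℤ.* j ≡ + 2 ℤ.* j ℤ.+ 1ℤ ℤ.- 1ℤ
  e₂ = ℤ-Solver.solve-∀
  -- The triangle inequality for 2j = (2j + 1) - 1 avoids a case distinction on the sign of j.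
  twice : ∀ j → 2 ℕ.* ℤ.∣ j ∣ ≤ ℤ.∣ odd j ∣ ℕ.+ 1
  twice j = ℕ.≤-trans (ℕ.≤-reflexive (trans (sym (ℤ.abs-* (+ 2) j)) (cong ℤ.∣_∣ (e₂ j)))) (ℤ.∣i-j∣≤∣i∣+∣j∣ (odd j) 1ℤ)
  halved : ∀ m k → 2 ℕ.* m ≤ k ℕ.+ 1 → m ≤ k
  halved zero k _ = z≤n
  halved (suc m) k l = ℕ.≤-trans (ℕ.m≤n+m (suc m) m) (ℕ.≤-pred (ℕ.≤-trans
    (ℕ.≤-reflexive (cong (λ w → suc (m ℕ.+ w)) (sym (ℕ.+-identityʳ (suc m)))))
    (ℕ.≤-trans l (ℕ.≤-reflexive (ℕ.+-comm k 1)))))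
  ∣j∣≤ : ∀ j → ℤ.∣ j ∣ ≤ ℤ.∣ odd j ∣
  ∣j∣≤ j = halved ℤ.∣ j ∣ ℤ.∣ odd j ∣ (twice j)

thetaPolynomialₛ : PS
thetaPolynomialₛ = thetaMon 7 0
   +ₛ ((+ 28 ·ₛ thetaMon 6 1)
   +ₛ ((+ 105 ·ₛ thetaMon 5 2)
   +ₛ ((+ 112 ·ₛ thetaMon 4 3)
   +ₛ ((+ 147 ·ₛ thetaMon 3 4)
   +ₛ ((+ 84 ·ₛ thetaMon 2 5)
   +ₛ (+ 35 ·ₛ thetaMon 1 6))))))

counts-thetaPolynomial : Counts (thetaPolynomial θ₃ θ₂) thetaPolynomialₛ
counts-thetaPolynomial =
  counts-⊕ (mon 7 0) (counts-⊕ (counts-multiple 28 (mon 6 1)) (counts-⊕ (counts-multiple 105 (mon 5 2))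
    (counts-⊕ (counts-multiple 112 (mon 4 3)) (counts-⊕ (counts-multiple 147 (mon 3 4))
    (counts-⊕ (counts-multiple 84 (mon 2 5)) (counts-multiple 35 (mon 1 6)))))))
  where
  mon : ∀ i j → Counts (monomial θ₃ θ₂ i j) (thetaMon i j)
  mon i j = counts-⊗ (counts-^ counts-θ₃ i) (counts-^ counts-θ₂ j)

-- Rows as finite sets of naturals

-- A finite set a₀ < a₁ < … of naturals is encoded by its gaps a₀, a₁ − a₀ − 1, a₂ − a₁ − 1, …
sumOver : (ℕ → ℤ) → List ℕ → ℤ
sumOver v [] = 0ℤ
sumOver v (g ∷ l) = v g ℤ.+ sumOver (λ i → v (suc (g ℕ.+ i))) l

sumOver-cong : ∀ {v w} → (∀ i → v i ≡ w i) → ∀ l → sumOver v l ≡ sumOver w l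
sumOver-cong e [] = refl
sumOver-cong e (g ∷ l) = cong₂ ℤ._+_ (e g) (sumOver-cong (λ i → e (suc (g ℕ.+ i))) l)

-- The product over i ≥ 0 of 1 + z^c q^(v i). Every list of gaps is a set, so no proof of order has
-- to be carried along.
Subsets : (ℕ → ℤ) → ℤ → GSet
Subsets v c .Carrier = List ℕ
Subsets v c .wt = sumOver v
Subsets v c .ch = sumOver (λ _ → c)

-- Adding 1 to every element changes only the first gap.
shiftUp : List ℕ → List ℕ
shiftUp [] = []
shiftUp (g ∷ l) = suc g ∷ l

sumOver-shiftUp : ∀ v l → sumOver v (shiftUp l) ≡ sumOver (λ i → v (suc i)) l
sumOver-shiftUp v [] = refl
sumOver-shiftUp v (g ∷ l) = refl

double : ℕ → ℕ
double zero = zero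
double (suc n) = suc (suc (double n))

-- The set of all 2i with i in the first argument and 2i + 1 with i in the second. Once position 0
-- has been dealt with, the rest is seen from position 1, where even and odd trade places; hence the
-- swapped arguments.
merge : List ℕ → List ℕ → List ℕ
merge [] [] = []
-- With no even elements two rounds are taken at once: a single swap would make neither argument
-- smaller.
merge [] (zero ∷ o) = shiftUp (0 ∷ merge [] o)
merge [] (suc h ∷ o) = shiftUp (shiftUp (merge [] (h ∷ o)))
merge (zero ∷ e) o = 0 ∷ merge o e
merge (suc g ∷ e) o = shiftUp (merge o (g ∷ e))

split : List ℕ → List ℕ × List ℕ
split [] = [] , []
split (zero ∷ l) = let (e , o) = split l in 0 ∷ o , e
split (suc g ∷ l) = let (e , o) = split (g ∷ l) in shiftUp o , e

split-shiftUp : ∀ l → split (shiftUp l) ≡ (shiftUp (proj₂ (split l)) , proj₁ (split l))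
split-shiftUp [] = refl
split-shiftUp (g ∷ l) = refl

merge-shiftUp : ∀ o e → merge (shiftUp o) e ≡ shiftUp (merge e o)
merge-shiftUp [] [] = refl
merge-shiftUp [] (zero ∷ e) = refl
merge-shiftUp [] (suc h ∷ e) = refl
merge-shiftUp (g ∷ o) e = refl

merge-split : ∀ l → merge (proj₁ (split l)) (proj₂ (split l)) ≡ l
merge-split [] = refl
merge-split (zero ∷ l) = cong (0 ∷_) (merge-split l)
merge-split (suc g ∷ l) = trans (merge-shiftUp (proj₂ (split (g ∷ l))) (proj₁ (split (g ∷ l))))
  (cong shiftUp (merge-split (g ∷ l)))

split-merge : ∀ e o → split (merge e o) ≡ (e , o)
split-merge [] [] = refl
split-merge [] (zero ∷ o) = cong (λ (e , o) → shiftUp e , 0 ∷ o) (split-merge [] o)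
split-merge [] (suc h ∷ o) = trans (split-shiftUp (shiftUp (merge [] (h ∷ o))))
  (cong (λ (e , o) → shiftUp o , e) (trans (split-shiftUp (merge [] (h ∷ o)))
    (cong (λ (e , o) → shiftUp o , e) (split-merge [] (h ∷ o)))))
split-merge (zero ∷ e) o = cong (λ (o , e) → 0 ∷ e , o) (split-merge o e)
split-merge (suc g ∷ e) o = trans (split-shiftUp (merge o (g ∷ e)))
  (cong (λ (o , e) → shiftUp e , o) (split-merge o (g ∷ e)))

sumOver-merge : ∀ v e o →
  sumOver v (merge e o) ≡ sumOver (λ i → v (double i)) e ℤ.+ sumOver (λ i → v (suc (double i))) o
sumOver-merge v [] [] = refl
sumOver-merge v [] (zero ∷ o) = trans (cong (λ w → v 1 ℤ.+ w) (sumOver-merge (λ i → v (suc (suc i))) [] o))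
  (x+[0+y]≡0+[x+y] (v 1) _)
  where
  x+[0+y]≡0+[x+y] : ∀ x y → x ℤ.+ (0ℤ ℤ.+ y) ≡ 0ℤ ℤ.+ (x ℤ.+ y)
  x+[0+y]≡0+[x+y] = ℤ-Solver.solve-∀
sumOver-merge v [] (suc h ∷ o) = trans (sumOver-shiftUp v (shiftUp (merge [] (h ∷ o))))
  (trans (sumOver-shiftUp (λ i → v (suc i)) (merge [] (h ∷ o))) (sumOver-merge (λ i → v (suc (suc i))) [] (h ∷ o)))
sumOver-merge v (zero ∷ e) o = trans (cong (λ w → v 0 ℤ.+ w) (sumOver-merge (λ i → v (suc i)) o e))
  (x+[y+z]≡[x+z]+y (v 0) _ _)
  where
  x+[y+z]≡[x+z]+y : ∀ x y z → x ℤ.+ (y ℤ.+ z) ≡ x ℤ.+ z ℤ.+ y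
  x+[y+z]≡[x+z]+y = ℤ-Solver.solve-∀
sumOver-merge v (suc g ∷ e) o = trans (sumOver-shiftUp v (merge o (g ∷ e)))
  (trans (sumOver-merge (λ i → v (suc i)) o (g ∷ e)) (ℤ.+-comm (sumOver (λ i → v (suc (double i))) o) _))

⌊double/2⌋ : ∀ n → ℕ.⌊ double n /2⌋ ≡ n
⌊double/2⌋ zero = refl
⌊double/2⌋ (suc n) = cong suc (⌊double/2⌋ n)

⌊suc-double/2⌋ : ∀ n → ℕ.⌊ suc (double n) /2⌋ ≡ n
⌊suc-double/2⌋ zero = refl
⌊suc-double/2⌋ (suc n) = cong suc (⌊suc-double/2⌋ n)

-- When every value occurs at two consecutive positions, the even and the odd positions are two
-- independent sets. Applied three times, this separates eight colours.
Subsets-⌊/2⌋ : ∀ v c → Subsets v c ⊗ Subsets v c ≅ Subsets (λ i → v ℕ.⌊ i /2⌋) c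
Subsets-⌊/2⌋ v c = iso
  (mk↔ₛ′ (λ (e , o) → merge e o) split merge-split (λ (e , o) → split-merge e o))
  (λ (e , o) → trans (sumOver-merge (λ i → v ℕ.⌊ i /2⌋) e o)
    (cong₂ ℤ._+_ (sumOver-cong (λ i → cong v (⌊double/2⌋ i)) e) (sumOver-cong (λ i → cong v (⌊suc-double/2⌋ i)) o)))
  (λ (e , o) → sumOver-merge (λ _ → c) e o)

-- Strictly decreasing rows and their gap lists

span : List ℕ → ℕ
span [] = 0
span (g ∷ l) = suc (g ℕ.+ span l)

span-∷ʳ : ∀ l g → span (l ∷ʳ g) ≡ suc (g ℕ.+ span l)
span-∷ʳ [] g = refl
span-∷ʳ (a ∷ l) g = trans (cong (λ k → suc (a ℕ.+ k)) (span-∷ʳ l g)) (swap a g (span l))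
  where
  swap : ∀ a g s → suc (a ℕ.+ suc (g ℕ.+ s)) ≡ suc (g ℕ.+ suc (a ℕ.+ s))
  swap = ℕ-Solver.solve-∀

span-reverse : ∀ l → span (List.reverse l) ≡ span l
span-reverse [] = refl
span-reverse (g ∷ l) = trans (cong span (List.unfold-reverse g l))
  (trans (span-∷ʳ (List.reverse l) g) (cong (λ k → suc (g ℕ.+ k)) (span-reverse l)))

sumOver-∷ʳ : ∀ v l g → sumOver v (l ∷ʳ g) ≡ v (g ℕ.+ span l) ℤ.+ sumOver v l
sumOver-∷ʳ v [] g = cong (λ k → v k ℤ.+ 0ℤ) (sym (ℕ.+-identityʳ g))
sumOver-∷ʳ v (a ∷ l) g = trans (cong (λ w → v a ℤ.+ w) (sumOver-∷ʳ (λ i → v (suc (a ℕ.+ i))) l g))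
  (trans (swap (v a) (v (suc (a ℕ.+ (g ℕ.+ span l)))) _) (cong (λ k → v k ℤ.+ sumOver v (a ∷ l)) (e a g (span l))))
  where
  swap : ∀ x y z → x ℤ.+ (y ℤ.+ z) ≡ y ℤ.+ (x ℤ.+ z)
  swap = ℤ-Solver.solve-∀
  e : ∀ a g s → suc (a ℕ.+ (g ℕ.+ s)) ≡ g ℕ.+ suc (a ℕ.+ s)
  e = ℕ-Solver.solve-∀

-- The head gap belongs to the largest element here, whereas `sumOver` starts from the smallest;
-- this is why `List.reverse` appears below. The number `span l` is one more than the largest
-- element, or 0, and ignores the order of the gaps.
elements : List ℕ → List ℕ
elements [] = []
elements (g ∷ l) = g ℕ.+ span l ∷ elements l

bound : List ℕ → ℕ
bound [] = 0
bound (x ∷ _) = suc x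

gaps : List ℕ → List ℕ
gaps [] = []
gaps (x ∷ l) = x ∸ bound l ∷ gaps l

bound-elements : ∀ l → bound (elements l) ≡ span l
bound-elements [] = refl
bound-elements (g ∷ l) = refl

gaps-elements : ∀ l → gaps (elements l) ≡ l
gaps-elements [] = refl
gaps-elements (g ∷ l) = cong₂ _∷_
  (trans (cong (g ℕ.+ span l ∸_) (bound-elements l)) (ℕ.m+n∸n≡m g (span l))) (gaps-elements l)

Descending : List ℕ → Set
Descending = Linked (λ x y → y < x)

elements-descending : ∀ l → Descending (elements l)
elements-descending [] = []
elements-descending (g ∷ []) = [-]
elements-descending (g ∷ h ∷ l) = ℕ.m≤n+m (suc (h ℕ.+ span l)) g ∷ elements-descending (h ∷ l)

elements-gaps : ∀ {l} → Descending l → elements (gaps l) ≡ l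
elements-gaps [] = refl
elements-gaps {x ∷ []} [-] = cong (_∷ []) (ℕ.+-identityʳ x)
elements-gaps {x ∷ y ∷ l} (y<x ∷ d) = cong₂ _∷_
  (trans (cong (x ∸ suc y ℕ.+_) (trans (sym (bound-elements (gaps (y ∷ l)))) (cong bound (elements-gaps d))))
    (ℕ.m∸n+n≡m y<x))
  (elements-gaps d)

sumOver-reverse : ∀ v l → sumOver v (List.reverse l) ≡ sumℤ (List.map v (elements l))
sumOver-reverse v [] = refl
sumOver-reverse v (g ∷ l) = trans (cong (sumOver v) (List.unfold-reverse g l))
  (trans (sumOver-∷ʳ v (List.reverse l) g)
    (cong₂ ℤ._+_ (cong (λ k → v (g ℕ.+ k)) (span-reverse l)) (sumOver-reverse v l)))

-- The position 8ℓ + c in the order `_≺_`, which turns a coloured row into a plain descending list;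
-- three halvings of it give back ℓ.
rank : ColNat 8 → ℕ
rank (zero , c) = Fin.toℕ c
rank (suc ℓ , c) = 8 ℕ.+ rank (ℓ , c)

unrank : ℕ → ColNat 8
unrank 0 = 0 , Fin.zero
unrank 1 = 0 , Fin.suc Fin.zero
unrank 2 = 0 , Fin.suc (Fin.suc Fin.zero)
unrank 3 = 0 , Fin.suc (Fin.suc (Fin.suc Fin.zero))
unrank 4 = 0 , Fin.suc (Fin.suc (Fin.suc (Fin.suc Fin.zero)))
unrank 5 = 0 , Fin.suc (Fin.suc (Fin.suc (Fin.suc (Fin.suc Fin.zero))))
unrank 6 = 0 , Fin.suc (Fin.suc (Fin.suc (Fin.suc (Fin.suc (Fin.suc Fin.zero)))))
unrank 7 = 0 , Fin.suc (Fin.suc (Fin.suc (Fin.suc (Fin.suc (Fin.suc (Fin.suc Fin.zero))))))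
unrank (suc (suc (suc (suc (suc (suc (suc (suc n)))))))) = let (ℓ , c) = unrank n in suc ℓ , c

rank-unrank : ∀ n → rank (unrank n) ≡ n
rank-unrank 0 = refl
rank-unrank 1 = refl
rank-unrank 2 = refl
rank-unrank 3 = refl
rank-unrank 4 = refl
rank-unrank 5 = refl
rank-unrank 6 = refl
rank-unrank 7 = refl
rank-unrank (suc (suc (suc (suc (suc (suc (suc (suc n)))))))) = cong (8 ℕ.+_) (rank-unrank n)

unrank-toℕ : ∀ (c : Fin 8) → unrank (Fin.toℕ c) ≡ (0 , c)
unrank-toℕ Fin.zero = refl
unrank-toℕ (Fin.suc Fin.zero) = refl
unrank-toℕ (Fin.suc (Fin.suc Fin.zero)) = refl
unrank-toℕ (Fin.suc (Fin.suc (Fin.suc Fin.zero))) = refl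
unrank-toℕ (Fin.suc (Fin.suc (Fin.suc (Fin.suc Fin.zero)))) = refl
unrank-toℕ (Fin.suc (Fin.suc (Fin.suc (Fin.suc (Fin.suc Fin.zero))))) = refl
unrank-toℕ (Fin.suc (Fin.suc (Fin.suc (Fin.suc (Fin.suc (Fin.suc Fin.zero)))))) = refl
unrank-toℕ (Fin.suc (Fin.suc (Fin.suc (Fin.suc (Fin.suc (Fin.suc (Fin.suc Fin.zero))))))) = refl

unrank-rank : ∀ x → unrank (rank x) ≡ x
unrank-rank (zero , c) = unrank-toℕ c
unrank-rank (suc ℓ , c) = cong (λ (ℓ , c) → suc ℓ , c) (unrank-rank (ℓ , c))

⌊⌊⌊_/2⌋/2⌋/2⌋ : ℕ → ℕ
⌊⌊⌊ n /2⌋/2⌋/2⌋ = ℕ.⌊ ℕ.⌊ ℕ.⌊ n /2⌋ /2⌋ /2⌋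

value-unrank : ∀ n → ⌊⌊⌊ n /2⌋/2⌋/2⌋ ≡ value (unrank n)
value-unrank 0 = refl
value-unrank 1 = refl
value-unrank 2 = refl
value-unrank 3 = refl
value-unrank 4 = refl
value-unrank 5 = refl
value-unrank 6 = refl
value-unrank 7 = refl
value-unrank (suc (suc (suc (suc (suc (suc (suc (suc n)))))))) = cong suc (value-unrank n)

rank-mono : ∀ x y → x ≺ y → rank x < rank y
rank-mono (zero , c) (suc b , d) (inj₁ _) = ℕ.≤-trans (Fin.toℕ<n c) (ℕ.m≤m+n 8 (rank (b , d)))
rank-mono (suc a , c) (suc b , d) (inj₁ (s≤s a<b)) = ℕ.+-monoʳ-< 8 (rank-mono (a , c) (b , d) (inj₁ a<b))
rank-mono (zero , c) (zero , d) (inj₂ (refl , c<d)) = c<d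
rank-mono (suc a , c) (suc a , d) (inj₂ (refl , c<d)) = ℕ.+-monoʳ-< 8 (rank-mono (a , c) (a , d) (inj₂ (refl , c<d)))

rank-reflects : ∀ x y → rank x < rank y → x ≺ y
rank-reflects (zero , c) (zero , d) l = inj₂ (refl , l)
rank-reflects (zero , c) (suc b , d) l = inj₁ (s≤s z≤n)
rank-reflects (suc a , c) (zero , d) l =
  contradiction (ℕ.<-trans l (Fin.toℕ<n d)) (ℕ.≤⇒≯ (ℕ.m≤m+n 8 (rank (a , c))))
rank-reflects (suc a , c) (suc b , d) l with rank-reflects (a , c) (b , d) (ℕ.+-cancelˡ-< 8 _ _ l)
... | inj₁ a<b = inj₁ (s≤s a<b)
... | inj₂ (refl , c<d) = inj₂ (refl , c<d)

≺-irrelevant : ∀ {x y : ColNat 8} (p q : x ≺ y) → p ≡ q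
≺-irrelevant (inj₁ l) (inj₁ l′) = cong inj₁ (ℕ.<-irrelevant l l′)
≺-irrelevant (inj₁ l) (inj₂ (e , _)) = contradiction e (ℕ.<⇒≢ l)
≺-irrelevant (inj₂ (e , _)) (inj₁ l) = contradiction e (ℕ.<⇒≢ l)
≺-irrelevant (inj₂ (e , l)) (inj₂ (e′ , l′)) = cong inj₂ (cong₂ _,_ (ℕ.≡-irrelevant e e′) (ℕ.<-irrelevant l l′))

Rows : (ℕ → ℤ) → ℤ → GSet
Rows v c .Carrier = Σ (List (ColNat 8)) StrictlyDecreasing
Rows v c .wt (r , _) = sumℤ (List.map (λ x → v (value x)) r)
Rows v c .ch (r , _) = sumℤ (List.map (λ _ → c) r)

row-≡ : ∀ {x y : Σ (List (ColNat 8)) StrictlyDecreasing} → proj₁ x ≡ proj₁ y → x ≡ y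
row-≡ {_ , p} {_ , q} refl = cong (_ ,_) (Linked.irrelevant ≺-irrelevant p q)

Rows-≅-Subsets : ∀ v c → Subsets (λ i → v ⌊⌊⌊ i /2⌋/2⌋/2⌋) c ≅ Rows v c
Rows-≅-Subsets v c = iso (mk↔ₛ′ to from to-from from-to) w e
  where
  to : List ℕ → Σ (List (ColNat 8)) StrictlyDecreasing
  to l = List.map unrank (elements (List.reverse l)) ,
    Linked.map⁺ (Linked.map (λ {x} {y} y<x → rank-reflects (unrank y) (unrank x)
      (ℕ.≤-trans (s≤s (ℕ.≤-reflexive (rank-unrank y))) (ℕ.≤-trans y<x (ℕ.≤-reflexive (sym (rank-unrank x))))))
      (elements-descending (List.reverse l)))
  from : Σ (List (ColNat 8)) StrictlyDecreasing → List ℕ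
  from (r , _) = List.reverse (gaps (List.map rank r))
  map-inverse : ∀ {A B : Set} {f : A → B} {g : B → A} → (∀ x → g (f x) ≡ x) → ∀ l → List.map g (List.map f l) ≡ l
  map-inverse e l = trans (sym (List.map-∘ l)) (trans (List.map-cong e l) (List.map-id l))
  to-from : ∀ x → to (from x) ≡ x
  to-from (r , d) = row-≡ (trans
    (cong (List.map unrank) (trans (cong elements (List.reverse-involutive (gaps (List.map rank r))))
      (elements-gaps (Linked.map⁺ (Linked.map (λ {x} {y} → rank-mono y x) d)))))
    (map-inverse unrank-rank r))
  from-to : ∀ l → from (to l) ≡ l
  from-to l = trans (cong (λ m → List.reverse (gaps m)) (map-inverse rank-unrank (elements (List.reverse l))))
    (trans (cong List.reverse (gaps-elements (List.reverse l))) (List.reverse-involutive l))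
  sum-≡ : ∀ (u : ℕ → ℤ) (u′ : ColNat 8 → ℤ) → (∀ i → u i ≡ u′ (unrank i)) → ∀ l →
    sumℤ (List.map u′ (proj₁ (to l))) ≡ sumOver u l
  sum-≡ u u′ e l = trans (cong sumℤ (trans (sym (List.map-∘ (elements (List.reverse l))))
      (List.map-cong (λ i → sym (e i)) (elements (List.reverse l)))))
    (trans (sym (sumOver-reverse u (List.reverse l))) (cong (sumOver u) (List.reverse-involutive l)))
  w : ∀ l → sumℤ (List.map (λ x → v (value x)) (proj₁ (to l))) ≡ sumOver (λ i → v ⌊⌊⌊ i /2⌋/2⌋/2⌋) l
  w = sum-≡ _ _ (λ i → cong v (value-unrank i))
  e : ∀ l → sumℤ (List.map (λ _ → c) (proj₁ (to l))) ≡ sumOver (λ _ → c) l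
  e = sum-≡ _ _ (λ _ → refl)

-- The triple product

sumOver-const : ∀ c l → sumOver (λ _ → c) l ≡ c ℤ.* + length l
sumOver-const c [] = sym (ℤ.*-zeroʳ c)
sumOver-const c (g ∷ l) = trans (cong (λ w → c ℤ.+ w) (sumOver-const c l)) (e c (+ length l))
  where
  e : ∀ c n → c ℤ.+ c ℤ.* n ≡ c ℤ.* (1ℤ ℤ.+ n)
  e = ℤ-Solver.solve-∀

sumOver-+ : ∀ v c l → sumOver (λ i → v i ℤ.+ c) l ≡ sumOver v l ℤ.+ c ℤ.* + length l
sumOver-+ v c [] = sym (trans (ℤ.+-identityˡ _) (ℤ.*-zeroʳ c))
sumOver-+ v c (g ∷ l) = trans (cong (λ w → v g ℤ.+ c ℤ.+ w) (sumOver-+ (λ i → v (suc (g ℕ.+ i))) c l))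
  (e (v g) c (sumOver (λ i → v (suc (g ℕ.+ i))) l) (+ length l))
  where
  e : ∀ x c y n → x ℤ.+ c ℤ.+ (y ℤ.+ c ℤ.* n) ≡ x ℤ.+ y ℤ.+ c ℤ.* (1ℤ ℤ.+ n)
  e = ℤ-Solver.solve-∀

-- An entry ℓ contributes ℓ + 1/2 to the exponent of q, in either row: each column is shared between its two entries.
entryWt : ℕ → ℤ
entryWt ℓ = + 8 ℤ.* (+ 2 ℤ.* + ℓ ℤ.+ 1ℤ)

entryWt-+ : ∀ k i → entryWt (k ℕ.+ i) ≡ entryWt i ℤ.+ + 16 ℤ.* + k
entryWt-+ k i = e (+ k) (+ i)
  where
  e : ∀ k i → + 8 ℤ.* (+ 2 ℤ.* (k ℤ.+ i) ℤ.+ 1ℤ) ≡ + 8 ℤ.* (+ 2 ℤ.* i ℤ.+ 1ℤ) ℤ.+ + 16 ℤ.* k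
  e = ℤ-Solver.solve-∀

sumOver-entryWt-+ : ∀ k l →
  sumOver (λ i → entryWt (k ℕ.+ i)) l ≡ sumOver entryWt l ℤ.+ + 16 ℤ.* + k ℤ.* + length l
sumOver-entryWt-+ k l = trans (sumOver-cong (entryWt-+ k) l) (sumOver-+ entryWt (+ 16 ℤ.* + k) l)

colour : GSet
colour = Subsets entryWt 1ℤ ⊗ Subsets entryWt (ℤ.- 1ℤ)

ch-colour : ∀ S T → ch colour (S , T) ≡ + length S ℤ.- + length T
ch-colour S T = cong₂ ℤ._+_ (trans (sumOver-const 1ℤ S) (ℤ.*-identityˡ (+ length S)))
  (trans (sumOver-const (ℤ.- 1ℤ) T) (ℤ.-1*i≡-i (+ length T)))

-- Moving the origin of a Maya diagram by one step: multiplying z by q in the triple product.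
up down : List ℕ × List ℕ → List ℕ × List ℕ
up (S , []) = 0 ∷ S , []
up (S , suc g ∷ T) = 0 ∷ S , g ∷ T
-- T lists the holes below the origin. With 0 in T the position that crosses the origin is empty, so
-- T loses it and S gains nothing; in the other two clauses it is occupied and becomes the element 0
-- of S.
up (S , zero ∷ T) = shiftUp S , T
down ([] , T) = [] , 0 ∷ T
down (suc g ∷ S , T) = g ∷ S , 0 ∷ T
down (zero ∷ S , T) = S , shiftUp T

down-up : ∀ x → down (up x) ≡ x
down-up (S , []) = refl
down-up (S , suc g ∷ T) = refl
down-up ([] , zero ∷ T) = refl
down-up (g ∷ S , zero ∷ T) = refl

up-down : ∀ x → up (down x) ≡ x
up-down ([] , T) = refl
up-down (suc g ∷ S , T) = refl
up-down (zero ∷ S , []) = refl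
up-down (zero ∷ S , g ∷ T) = refl

ch-up : ∀ x → ch colour (up x) ≡ ch colour x ℤ.+ 1ℤ
ch-up (S , []) = e (ch (Subsets entryWt 1ℤ) S)
  where
  e : ∀ s → 1ℤ ℤ.+ s ℤ.+ 0ℤ ≡ s ℤ.+ 0ℤ ℤ.+ 1ℤ
  e = ℤ-Solver.solve-∀
ch-up (S , suc g ∷ T) = e (ch (Subsets entryWt 1ℤ) S) (ch (Subsets entryWt (ℤ.- 1ℤ)) (g ∷ T))
  where
  e : ∀ s t → 1ℤ ℤ.+ s ℤ.+ t ≡ s ℤ.+ t ℤ.+ 1ℤ
  e = ℤ-Solver.solve-∀
ch-up (S , zero ∷ T) = trans (cong (ℤ._+ t) (sumOver-shiftUp (λ _ → 1ℤ) S)) (e (ch (Subsets entryWt 1ℤ) S) t)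
  where
  t : ℤ
  t = ch (Subsets entryWt (ℤ.- 1ℤ)) T
  e : ∀ s t → s ℤ.+ t ≡ s ℤ.+ (ℤ.- 1ℤ ℤ.+ t) ℤ.+ 1ℤ
  e = ℤ-Solver.solve-∀

-- Each element of S rises by 1 and each element of T falls by 1, which gives 16 times the charge;
-- the position crossing the origin accounts for the remaining 8.
wt-up : ∀ x → wt colour (up x) ≡ wt colour x ℤ.+ + 8 ℤ.* (+ 2 ℤ.* ch colour x ℤ.+ 1ℤ)
wt-up (S , []) rewrite ch-colour S [] | sumOver-entryWt-+ 1 S = e (sumOver entryWt S) (+ length S)
  where
  e : ∀ s m → + 8 ℤ.+ (s ℤ.+ + 16 ℤ.* m) ℤ.+ 0ℤ ≡ s ℤ.+ 0ℤ ℤ.+ + 8 ℤ.* (+ 2 ℤ.* (m ℤ.- 0ℤ) ℤ.+ 1ℤ)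
  e = ℤ-Solver.solve-∀
wt-up (S , suc g ∷ T) rewrite ch-colour S (suc g ∷ T) | sumOver-entryWt-+ 1 S =
  trans (e (sumOver entryWt S) (sumOver entryWt (g ∷ T)) (+ length S) (+ length T))
    (cong (λ w → sumOver entryWt S ℤ.+ w ℤ.+ _) (sym (sumOver-entryWt-+ 1 (g ∷ T))))
  where
  e : ∀ s t m n → + 8 ℤ.+ (s ℤ.+ + 16 ℤ.* m) ℤ.+ t ≡
    s ℤ.+ (t ℤ.+ + 16 ℤ.* (1ℤ ℤ.+ n)) ℤ.+ + 8 ℤ.* (+ 2 ℤ.* (m ℤ.- (1ℤ ℤ.+ n)) ℤ.+ 1ℤ)
  e = ℤ-Solver.solve-∀
wt-up (S , zero ∷ T)
  rewrite ch-colour S (zero ∷ T) | sumOver-shiftUp entryWt S | sumOver-entryWt-+ 1 S | sumOver-entryWt-+ 1 T =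
  e (sumOver entryWt S) (sumOver entryWt T) (+ length S) (+ length T)
  where
  e : ∀ s t m n → s ℤ.+ + 16 ℤ.* m ℤ.+ t ≡
    s ℤ.+ (+ 8 ℤ.+ (t ℤ.+ + 16 ℤ.* n)) ℤ.+ + 8 ℤ.* (+ 2 ℤ.* (m ℤ.- (1ℤ ℤ.+ n)) ℤ.+ 1ℤ)
  e = ℤ-Solver.solve-∀

ups downs : ℕ → List ℕ × List ℕ → List ℕ × List ℕ
ups zero x = x
ups (suc n) x = up (ups n x)
downs zero x = x
downs (suc n) x = downs n (down x)

downs-ups : ∀ n x → downs n (ups n x) ≡ x
downs-ups zero x = refl
downs-ups (suc n) x = trans (cong (downs n) (down-up (ups n x))) (downs-ups n x)

ups-downs : ∀ n x → ups n (downs n x) ≡ x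
ups-downs zero x = refl
ups-downs (suc n) x = trans (cong up (ups-downs n (down x))) (up-down x)

ch-ups : ∀ n x → ch colour (ups n x) ≡ ch colour x ℤ.+ + n
ch-ups zero x = sym (ℤ.+-identityʳ _)
ch-ups (suc n) x = trans (ch-up (ups n x)) (trans (cong (ℤ._+ 1ℤ) (ch-ups n x)) (e (ch colour x) (+ n)))
  where
  e : ∀ c n → c ℤ.+ n ℤ.+ 1ℤ ≡ c ℤ.+ (1ℤ ℤ.+ n)
  e = ℤ-Solver.solve-∀

-- The weight minus 8 times the square of the charge is invariant: the correction is 8 ((c + n)² -
-- c²), with c the charge.
wt-ups : ∀ n x → wt colour (ups n x) ≡ wt colour x ℤ.+ + 8 ℤ.* (+ 2 ℤ.* + n ℤ.* ch colour x ℤ.+ + n ℤ.* + n)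
wt-ups zero x = sym (ℤ.+-identityʳ _)
wt-ups (suc n) x = trans (wt-up (ups n x))
  (trans (cong₂ (λ w c → w ℤ.+ + 8 ℤ.* (+ 2 ℤ.* c ℤ.+ 1ℤ)) (wt-ups n x) (ch-ups n x))
    (e (wt colour x) (ch colour x) (+ n)))
  where
  e : ∀ w c n → w ℤ.+ + 8 ℤ.* (+ 2 ℤ.* n ℤ.* c ℤ.+ n ℤ.* n) ℤ.+ + 8 ℤ.* (+ 2 ℤ.* (c ℤ.+ n) ℤ.+ 1ℤ)
    ≡ w ℤ.+ + 8 ℤ.* (+ 2 ℤ.* (1ℤ ℤ.+ n) ℤ.* c ℤ.+ (1ℤ ℤ.+ n) ℤ.* (1ℤ ℤ.+ n))
  e = ℤ-Solver.solve-∀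

ch-downs : ∀ n x → ch colour (downs n x) ≡ ch colour x ℤ.- + n
ch-downs n x = trans (e (ch colour (downs n x)) (+ n))
  (cong (ℤ._- + n) (trans (sym (ch-ups n (downs n x))) (cong (ch colour) (ups-downs n x))))
  where
  e : ∀ c n → c ≡ c ℤ.+ n ℤ.- n
  e = ℤ-Solver.solve-∀

wt-downs : ∀ n x → wt colour (downs n x) ≡
  wt colour x ℤ.+ + 8 ℤ.* (+ 2 ℤ.* (ℤ.- + n) ℤ.* ch colour x ℤ.+ (ℤ.- + n) ℤ.* (ℤ.- + n))
wt-downs n x = trans (e (wt colour y) (ch colour y) (+ n))
  (cong₂ (λ w c → w ℤ.+ + 8 ℤ.* (+ 2 ℤ.* (ℤ.- + n) ℤ.* c ℤ.+ (ℤ.- + n) ℤ.* (ℤ.- + n)))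
    (trans (sym (wt-ups n y)) (cong (wt colour) (ups-downs n x)))
    (trans (sym (ch-ups n y)) (cong (ch colour) (ups-downs n x))))
  where
  y : List ℕ × List ℕ
  y = downs n x
  e : ∀ w c n → w ≡ w ℤ.+ + 8 ℤ.* (+ 2 ℤ.* n ℤ.* c ℤ.+ n ℤ.* n)
    ℤ.+ + 8 ℤ.* (+ 2 ℤ.* (ℤ.- n) ℤ.* (c ℤ.+ n) ℤ.+ (ℤ.- n) ℤ.* (ℤ.- n))
  e = ℤ-Solver.solve-∀

translate : ℤ → List ℕ × List ℕ → List ℕ × List ℕ
translate (+ n) = ups n
translate -[1+ n ] = downs (suc n)

translate-neg : ∀ k x → translate (ℤ.- k) (translate k x) ≡ x
translate-neg (+ zero) x = refl
translate-neg (+ suc n) x = downs-ups (suc n) x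
translate-neg -[1+ n ] x = ups-downs (suc n) x

ch-translate : ∀ k x → ch colour (translate k x) ≡ ch colour x ℤ.+ k
ch-translate (+ n) x = ch-ups n x
ch-translate -[1+ n ] x = ch-downs (suc n) x

wt-translate : ∀ k x → wt colour (translate k x) ≡ wt colour x ℤ.+ + 8 ℤ.* (+ 2 ℤ.* k ℤ.* ch colour x ℤ.+ k ℤ.* k)
wt-translate (+ n) x = wt-ups n x
wt-translate -[1+ n ] x = wt-downs (suc n) x

-- The charge records how far the origin has been moved, so moving it back recovers the neutral
-- diagram. Starting from charge 0, a move by k costs 8k², the weight of k in `θ`.
triple-product : neutral colour ⊗ θ ≅ colour
triple-product = iso (mk↔ₛ′ to from to-from from-to)
  (λ ((x , p) , k) → trans (wt-translate k x)
    (trans (cong (λ c → wt colour x ℤ.+ + 8 ℤ.* (+ 2 ℤ.* k ℤ.* c ℤ.+ k ℤ.* k)) p) (e₁ (wt colour x) k)))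
  (λ ((x , p) , k) → trans (ch-translate k x) (e₂ (ch colour x) k))
  where
  e₁ : ∀ w k → w ℤ.+ + 8 ℤ.* (+ 2 ℤ.* k ℤ.* 0ℤ ℤ.+ k ℤ.* k) ≡ w ℤ.+ + 8 ℤ.* ((1ℤ ℤ.* k ℤ.+ 0ℤ) ℤ.* (1ℤ ℤ.* k ℤ.+ 0ℤ))
  e₁ = ℤ-Solver.solve-∀
  e₂ : ∀ c k → c ℤ.+ k ≡ c ℤ.+ 1ℤ ℤ.* (1ℤ ℤ.* k ℤ.+ 0ℤ)
  e₂ = ℤ-Solver.solve-∀
  to : Carrier (neutral colour) × ℤ → Carrier colour
  to ((x , _) , k) = translate k x
  from : Carrier colour → Carrier (neutral colour) × ℤ
  from y =
    (translate (ℤ.- ch colour y) y , trans (ch-translate (ℤ.- ch colour y) y) (ℤ.+-inverseʳ (ch colour y))) , ch colour y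
  to-from : ∀ y → to (from y) ≡ y
  to-from y = trans (cong (λ k → translate k (translate (ℤ.- ch colour y) y)) (sym (ℤ.neg-involutive (ch colour y))))
    (translate-neg (ℤ.- ch colour y) y)
  from-to : ∀ z → from (to z) ≡ z
  from-to ((x , p) , k) = cong₂ _,_
    (neutral-≡ colour (trans (cong (λ c → translate (ℤ.- c) (translate k x)) ch≡) (translate-neg k x))) ch≡
    where
    ch≡ : ch colour (translate k x) ≡ k
    ch≡ = trans (ch-translate k x) (trans (cong (ℤ._+ k) p) (ℤ.+-identityˡ k))

-- Neutral Maya diagrams and partitions

-- The excess over 0 + 1 + … + (|S| − 1) of the sum of the elements of a finite set S.
excess : List ℕ → ℕ
excess [] = 0
excess (g ∷ l) = excess l ℕ.+ suc (length l) ℕ.* g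

sumOver-entryWt : ∀ l → sumOver entryWt l ≡ + (8 ℕ.* (length l ℕ.* length l) ℕ.+ 16 ℕ.* excess l)
sumOver-entryWt l = trans (sumOver-excess l) (sym (cong₂ ℤ._+_
    (trans (ℤ.pos-* 8 (length l ℕ.* length l)) (cong (+ 8 ℤ.*_) (ℤ.pos-* (length l) (length l)))) (ℤ.pos-* 16 (excess l))))
  where
  e : ∀ g n x → + 8 ℤ.* (+ 2 ℤ.* g ℤ.+ 1ℤ) ℤ.+ (+ 8 ℤ.* (n ℤ.* n) ℤ.+ + 16 ℤ.* x ℤ.+ + 16 ℤ.* (1ℤ ℤ.+ g) ℤ.* n)
    ≡ + 8 ℤ.* ((1ℤ ℤ.+ n) ℤ.* (1ℤ ℤ.+ n)) ℤ.+ + 16 ℤ.* (x ℤ.+ (1ℤ ℤ.+ n) ℤ.* g)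
  e = ℤ-Solver.solve-∀
  sumOver-excess : ∀ l → sumOver entryWt l ≡ + 8 ℤ.* (+ length l ℤ.* + length l) ℤ.+ + 16 ℤ.* + excess l
  sumOver-excess [] = refl
  sumOver-excess (g ∷ l) = trans
    (cong (λ w → entryWt g ℤ.+ w) (trans (sumOver-entryWt-+ (suc g) l)
      (cong (ℤ._+ + 16 ℤ.* + suc g ℤ.* + length l) (sumOver-excess l))))
    (trans (e (+ g) (+ length l) (+ excess l))
      (cong (λ w → + 8 ℤ.* (+ suc (length l) ℤ.* + suc (length l)) ℤ.+ + 16 ℤ.* (+ excess l ℤ.+ w))
        (sym (ℤ.pos-* (suc (length l)) g))))

multiples : ℕ → GSet
multiples j .Carrier = ℕ
multiples j .wt g = + (16 ℕ.* (j ℕ.* g))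
multiples j .ch _ = 0ℤ

counts-multiples : ∀ j → Counts (multiples (suc j)) (geometricₛ (suc j))
counts-multiples j = counts (suc j ℕ.*_) (λ _ → refl) (λ n → sized-dec (suc j ∣? n)
  (λ (divides q e) → q , trans (ℕ.*-comm (suc j) q) (sym e))
  (λ (g , e) → divides g (trans (sym e) (ℕ.*-comm (suc j) g)))
  (λ (g , p) (h , q) → fibre-≡ (suc j ℕ.*_) (ℕ.*-cancelˡ-≡ g h (suc j) (trans p (sym q)))))

Parts : ℕ → GSet
Parts zero = 𝟙
Parts (suc m) = Parts m ⊗ multiples (suc m)

counts-Parts : ∀ m → Counts (Parts m) (partsₛ m)
counts-Parts zero = counts-𝟙
counts-Parts (suc m) = counts-⊗ (counts-Parts m) (counts-multiples m)

-- The first gap of an m-element set lifts all m elements, the next one m - 1 of them, and so on.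
-- The gaps are therefore the multiplicities of the parts m, m - 1, ..., 1 of a partition of the
-- excess.
gapsOfParts : ∀ m → Carrier (Parts m) → List ℕ
gapsOfParts zero _ = []
gapsOfParts (suc m) (p , g) = g ∷ gapsOfParts m p

length-gapsOfParts : ∀ m p → length (gapsOfParts m p) ≡ m
length-gapsOfParts zero _ = refl
length-gapsOfParts (suc m) (p , g) = cong suc (length-gapsOfParts m p)

excess-gapsOfParts : ∀ m p → excess (gapsOfParts m p) ≡ Counts.deg (counts-Parts m) p
excess-gapsOfParts zero _ = refl
excess-gapsOfParts (suc m) (p , g) = cong₂ ℕ._+_ (excess-gapsOfParts m p)
  (cong (λ k → suc k ℕ.* g) (length-gapsOfParts m p))

partsOfGaps : ∀ m (l : List ℕ) → length l ≡ m → Carrier (Parts m)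
partsOfGaps zero [] _ = tt
partsOfGaps (suc m) (g ∷ l) e = partsOfGaps m l (ℕ.suc-injective e) , g

gaps-parts : ∀ m l (e : length l ≡ m) → gapsOfParts m (partsOfGaps m l e) ≡ l
gaps-parts zero [] _ = refl
gaps-parts (suc m) (g ∷ l) e = cong (g ∷_) (gaps-parts m l (ℕ.suc-injective e))

parts-gaps : ∀ m p (e : length (gapsOfParts m p) ≡ m) → partsOfGaps m (gapsOfParts m p) e ≡ p
parts-gaps zero _ _ = refl
parts-gaps (suc m) (p , g) e = cong (_, g) (parts-gaps m p (ℕ.suc-injective e))

-- For a neutral diagram this is the size of the partition with Frobenius coordinates S and T; the
-- square is its Durfee square.
degree : List ℕ × List ℕ → ℕ
degree (S , T) = length S ℕ.* length S ℕ.+ excess S ℕ.+ excess T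

wt-colour : ∀ S T → wt colour (S , T) ≡
  + (8 ℕ.* (length S ℕ.* length S ℕ.+ length T ℕ.* length T) ℕ.+ 16 ℕ.* (excess S ℕ.+ excess T))
wt-colour S T = trans (cong₂ ℤ._+_ (sumOver-entryWt S) (sumOver-entryWt T))
  (cong +_ (e (length S ℕ.* length S) (length T ℕ.* length T) (excess S) (excess T)))
  where
  e : ∀ m n x y → 8 ℕ.* m ℕ.+ 16 ℕ.* x ℕ.+ (8 ℕ.* n ℕ.+ 16 ℕ.* y) ≡ 8 ℕ.* (m ℕ.+ n) ℕ.+ 16 ℕ.* (x ℕ.+ y)
  e = ℕ-Solver.solve-∀

length-≡ : ∀ S T n → ch colour (S , T) ≡ + n → length S ≡ n ℕ.+ length T
length-≡ S T n p = ℤ.+-injective (trans (e (+ length S) (+ length T))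
  (cong (ℤ._+ + length T) (trans (sym (ch-colour S T)) p)))
  where
  e : ∀ s t → s ≡ s ℤ.- t ℤ.+ t
  e = ℤ-Solver.solve-∀

wt-degree : ∀ x → ch colour x ≡ 0ℤ → wt colour x ≡ + (16 ℕ.* degree x)
wt-degree (S , T) p = trans (wt-colour S T) (cong +_ (trans
    (cong (λ k → 8 ℕ.* (length S ℕ.* length S ℕ.+ k ℕ.* k) ℕ.+ 16 ℕ.* (excess S ℕ.+ excess T)) (sym (length-≡ S T 0 p)))
    (e (length S ℕ.* length S) (excess S) (excess T))))
  where
  e : ∀ m x y → 8 ℕ.* (m ℕ.+ m) ℕ.+ 16 ℕ.* (x ℕ.+ y) ≡ 16 ℕ.* (m ℕ.+ x ℕ.+ y)
  e = ℕ-Solver.solve-∀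

-- With r ≥ 1 elements in T the weight would be at least 8 ((n + r)² + r²) > 8 n² + 16 n.
empty-bottom : ∀ n S T → ch colour (S , T) ≡ + n → wt colour (S , T) ≡ + (8 ℕ.* (n ℕ.* n) ℕ.+ 16 ℕ.* n) →
  T ≡ [] × length S ≡ n × excess S ≡ n
empty-bottom n S T p q = go T (length-≡ S T n p) (ℤ.+-injective (trans (sym (wt-colour S T)) q))
  where
  e₁ : ∀ n x → 8 ℕ.* ((n ℕ.+ 0) ℕ.* (n ℕ.+ 0) ℕ.+ 0) ℕ.+ 16 ℕ.* (x ℕ.+ 0) ≡ 8 ℕ.* (n ℕ.* n) ℕ.+ 16 ℕ.* x
  e₁ = ℕ-Solver.solve-∀
  e₂ : ∀ n r x → 8 ℕ.* ((n ℕ.+ suc r) ℕ.* (n ℕ.+ suc r) ℕ.+ suc r ℕ.* suc r) ℕ.+ 16 ℕ.* x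
    ≡ 8 ℕ.* (n ℕ.* n) ℕ.+ 16 ℕ.* n ℕ.+ suc (15 ℕ.+ 16 ℕ.* n ℕ.* r ℕ.+ 16 ℕ.* (r ℕ.* r) ℕ.+ 32 ℕ.* r ℕ.+ 16 ℕ.* x)
  e₂ = ℕ-Solver.solve-∀
  go : ∀ T → length S ≡ n ℕ.+ length T →
    8 ℕ.* (length S ℕ.* length S ℕ.+ length T ℕ.* length T) ℕ.+ 16 ℕ.* (excess S ℕ.+ excess T)
      ≡ 8 ℕ.* (n ℕ.* n) ℕ.+ 16 ℕ.* n →
    T ≡ [] × length S ≡ n × excess S ≡ n
  go [] l w rewrite l = refl , ℕ.+-identityʳ n ,
    ℕ.*-cancelˡ-≡ (excess S) n 16 (ℕ.+-cancelˡ-≡ (8 ℕ.* (n ℕ.* n)) _ _ (trans (sym (e₁ n (excess S))) w))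
  go T@(_ ∷ T′) l w rewrite l =
    contradiction (trans (sym (e₂ n (length T′) (excess S ℕ.+ excess T))) w) (ℕ.m+1+n≢m _)

-- Raising the charge to n leaves no room below the origin, so a fibre of degree n consists of the partitions
-- of n into parts of size at most n.
neutral-fibre : ∀ n → Fibre (Counts.deg (counts-Parts n)) n ↔ Fibre {Carrier (neutral colour)} (λ (x , _) → degree x) n
neutral-fibre n = mk↔ₛ′ to from to-from from-to
  where
  -- Moving a neutral diagram of degree n up by n produces the weight 16n + 8n². The charge n
  -- already demands 8n², so an excess of n is all that remains.
  raised : ∀ x → ch colour x ≡ 0ℤ → degree x ≡ n →
    proj₂ (ups n x) ≡ [] × length (proj₁ (ups n x)) ≡ n × excess (proj₁ (ups n x)) ≡ n
  raised x p q = empty-bottom n (proj₁ (ups n x)) (proj₂ (ups n x))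
    (trans (ch-ups n x) (trans (cong (ℤ._+ + n) p) (ℤ.+-identityˡ (+ n))))
    (trans (wt-ups n x) (trans (cong₂ (λ w c → w ℤ.+ + 8 ℤ.* (+ 2 ℤ.* + n ℤ.* c ℤ.+ + n ℤ.* + n))
        (trans (wt-degree x p) (trans (cong (λ d → + (16 ℕ.* d)) q) (ℤ.pos-* 16 n))) p)
      (trans (e (+ n)) (sym (cong₂ ℤ._+_ (trans (ℤ.pos-* 8 (n ℕ.* n)) (cong (+ 8 ℤ.*_) (ℤ.pos-* n n))) (ℤ.pos-* 16 n))))))
    where
    e : ∀ n → + 16 ℤ.* n ℤ.+ + 8 ℤ.* (+ 2 ℤ.* n ℤ.* 0ℤ ℤ.+ n ℤ.* n) ≡ + 8 ℤ.* (n ℤ.* n) ℤ.+ + 16 ℤ.* n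
    e = ℤ-Solver.solve-∀

  lowered-ch : ∀ S → length S ≡ n → ch colour (downs n (S , [])) ≡ 0ℤ
  lowered-ch S l = trans (ch-downs n (S , []))
    (trans (cong (ℤ._- + n) (trans (ch-colour S []) (trans (ℤ.+-identityʳ (+ length S)) (cong +_ l)))) (ℤ.+-inverseʳ (+ n)))

  lowered-degree : ∀ S → length S ≡ n → excess S ≡ n → degree (downs n (S , [])) ≡ n
  lowered-degree S l x = ℕ.*-cancelˡ-≡ _ n 16 (ℤ.+-injective (begin
    + (16 ℕ.* degree y)
      ≡⟨ wt-degree y (lowered-ch S l) ⟨
    wt colour y
      ≡⟨ wt-downs n (S , []) ⟩
    wt colour (S , []) ℤ.+ + 8 ℤ.* (+ 2 ℤ.* (ℤ.- + n) ℤ.* ch colour (S , []) ℤ.+ (ℤ.- + n) ℤ.* (ℤ.- + n))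
      ≡⟨ cong₂ (λ w c → w ℤ.+ + 8 ℤ.* (+ 2 ℤ.* (ℤ.- + n) ℤ.* c ℤ.+ (ℤ.- + n) ℤ.* (ℤ.- + n))) wt≡
           (trans (ch-colour S []) (trans (ℤ.+-identityʳ (+ length S)) (cong +_ l))) ⟩
    + 8 ℤ.* (+ n ℤ.* + n) ℤ.+ + 16 ℤ.* + n ℤ.+ + 8 ℤ.* (+ 2 ℤ.* (ℤ.- + n) ℤ.* + n ℤ.+ (ℤ.- + n) ℤ.* (ℤ.- + n))
      ≡⟨ e (+ n) ⟩
    + 16 ℤ.* + n
      ≡⟨ ℤ.pos-* 16 n ⟨
    + (16 ℕ.* n) ∎))
    where
    open ≡-Reasoning
    y : List ℕ × List ℕ
    y = downs n (S , [])
    e : ∀ n → + 8 ℤ.* (n ℤ.* n) ℤ.+ + 16 ℤ.* n ℤ.+ + 8 ℤ.* (+ 2 ℤ.* (ℤ.- n) ℤ.* n ℤ.+ (ℤ.- n) ℤ.* (ℤ.- n)) ≡ + 16 ℤ.* n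
    e = ℤ-Solver.solve-∀
    wt≡ : wt colour (S , []) ≡ + 8 ℤ.* (+ n ℤ.* + n) ℤ.+ + 16 ℤ.* + n
    wt≡ = trans (ℤ.+-identityʳ _) (trans (sumOver-entryWt S)
      (trans (cong₂ (λ k m → + (8 ℕ.* (k ℕ.* k) ℕ.+ 16 ℕ.* m)) l x)
        (cong₂ ℤ._+_ (trans (ℤ.pos-* 8 (n ℕ.* n)) (cong (+ 8 ℤ.*_) (ℤ.pos-* n n))) (ℤ.pos-* 16 n))))

  fibre-≡′ : ∀ {x y : Fibre {Carrier (neutral colour)} (λ (x , _) → degree x) n} →
    proj₁ (proj₁ x) ≡ proj₁ (proj₁ y) → x ≡ y
  fibre-≡′ e = fibre-≡ _ (neutral-≡ colour e)

  to : Fibre (Counts.deg (counts-Parts n)) n → Fibre {Carrier (neutral colour)} (λ (x , _) → degree x) n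
  to (p , e) = (downs n (S , []) , lowered-ch S l) , lowered-degree S l (trans (excess-gapsOfParts n p) e)
    where
    S : List ℕ
    S = gapsOfParts n p
    l : length S ≡ n
    l = length-gapsOfParts n p

  from : Fibre {Carrier (neutral colour)} (λ (x , _) → degree x) n → Fibre (Counts.deg (counts-Parts n)) n
  from ((x , p) , q) = let (_ , l , d) = raised x p q in
    partsOfGaps n (proj₁ (ups n x)) l ,
    trans (sym (excess-gapsOfParts n _)) (trans (cong excess (gaps-parts n (proj₁ (ups n x)) l)) d)

  to-from : ∀ z → to (from z) ≡ z
  to-from ((x , p) , q) = let (t , l , _) = raised x p q in fibre-≡′
    (trans (cong (downs n) (cong₂ _,_ (gaps-parts n (proj₁ (ups n x)) l) (sym t))) (downs-ups n x))

  from-to : ∀ z → from (to z) ≡ z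
  from-to z@(p , e) = fibre-≡ (Counts.deg (counts-Parts n))
    (partsOfGaps-≡ (cong proj₁ (ups-downs n (gapsOfParts n p , [])))
      (proj₁ (proj₂ (raised (proj₁ (proj₁ (to z))) (proj₂ (proj₁ (to z))) (proj₂ (to z))))))
    where
    partsOfGaps-≡ : ∀ {l} → l ≡ gapsOfParts n p → ∀ e → partsOfGaps n l e ≡ p
    partsOfGaps-≡ refl e = parts-gaps n p e

-- The bijection may depend on n: `partitionsₛ n` is by definition the coefficient n of `partsₛ n`.
counts-neutral-colour : Counts (neutral colour) partitionsₛ
counts-neutral-colour = counts (λ (x , _) → degree x) (λ (x , p) → wt-degree x p)
  (λ n → sized-↔ (neutral-fibre n) (Counts.sized (counts-Parts n) n))

-- Eight colours and Frobenius symbols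

coloured-subsets : ∀ v c → Rows v c ≅ Subsets v c ^ 8
coloured-subsets v c = begin
  Rows v c                       ≈⟨ Rows-≅-Subsets v c ⟨
  Subsets (λ i → v ⌊⌊⌊ i /2⌋/2⌋/2⌋) c
                                 ≈⟨ Subsets-⌊/2⌋ (λ i → v ℕ.⌊ ℕ.⌊ i /2⌋ /2⌋) c ⟨
  X₄ ⊗ X₄                        ≈⟨ ⊗-cong (Subsets-⌊/2⌋ _ c) (Subsets-⌊/2⌋ _ c) ⟨
  (X₂ ⊗ X₂) ⊗ (X₂ ⊗ X₂)          ≈⟨ ⊗-cong four four ⟨
  ((X ⊗ X) ⊗ (X ⊗ X)) ⊗ ((X ⊗ X) ⊗ (X ⊗ X))
                                 ≈⟨ iterated-square X ⟩
  X ^ 8                          ∎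
  where
  open import Relation.Binary.Reasoning.Setoid (CommutativeSemiring.setoid gset-semiring)
  X X₂ X₄ : GSet
  X = Subsets v c
  X₂ = Subsets (λ i → v ℕ.⌊ i /2⌋) c
  X₄ = Subsets (λ i → v ℕ.⌊ ℕ.⌊ i /2⌋ /2⌋) c
  four : (X ⊗ X) ⊗ (X ⊗ X) ≅ X₂ ⊗ X₂
  four = ⊗-cong (Subsets-⌊/2⌋ v c) (Subsets-⌊/2⌋ v c)

arrays : GSet
arrays = Rows entryWt 1ℤ ⊗ Rows entryWt (ℤ.- 1ℤ)

^-cong : ∀ {X Y} n → X ≅ Y → X ^ n ≅ Y ^ n
^-cong zero i = ≅-refl
^-cong (suc n) i = ⊗-cong i (^-cong n i)

uncharged-^ : ∀ {X} n → Uncharged X → Uncharged (X ^ n)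
uncharged-^ zero u = uncharged λ _ → refl
uncharged-^ (suc n) u = uncharged-⊗ u (uncharged-^ n u)

neutral-arrays : neutral arrays ≅ neutral colour ^ 8 ⊗ thetaPolynomial θ₃ θ₂
neutral-arrays = begin
  neutral arrays
    ≈⟨ neutral-cong (⊗-cong (coloured-subsets entryWt 1ℤ) (coloured-subsets entryWt (ℤ.- 1ℤ))) ⟩
  neutral (Subsets entryWt 1ℤ ^ 8 ⊗ Subsets entryWt (ℤ.- 1ℤ) ^ 8)
    ≈⟨ neutral-cong (^-distrib-* (Subsets entryWt 1ℤ) (Subsets entryWt (ℤ.- 1ℤ)) 8) ⟨
  neutral (colour ^ 8)
    ≈⟨ neutral-cong (^-cong 8 triple-product) ⟨
  neutral ((neutral colour ⊗ θ) ^ 8)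
    ≈⟨ neutral-cong (^-distrib-* (neutral colour) θ 8) ⟩
  neutral (neutral colour ^ 8 ⊗ θ ^ 8)
    -- The factor `neutral colour ^ 8` is free of z, so the constant term only concerns θ(z)⁸.
    ≈⟨ neutral-⊗ (θ ^ 8) (uncharged-^ 8 (uncharged proj₂)) ⟩
  neutral colour ^ 8 ⊗ neutral (θ ^ 8)
    ≈⟨ ⊗-cong ≅-refl neutral-θ⁸ ⟩
  neutral colour ^ 8 ⊗ thetaPolynomial θ₃ θ₂ ∎
  where
  open import Relation.Binary.Reasoning.Setoid (CommutativeSemiring.setoid gset-semiring)
  open import Algebra.Properties.CommutativeSemiring.Exp gset-semiring using (^-distrib-*)

counts-neutral-arrays : Counts (neutral arrays) rhs6p3
counts-neutral-arrays = counts-cong (≅-sym neutral-arrays) (PSR.*-congʳ {thetaPolynomialₛ} partitionsₛ⁸)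
  (counts-⊗ (counts-^ counts-neutral-colour 8) counts-thetaPolynomial)

charge-row : ∀ c (r : List (ColNat 8)) → sumℤ (List.map (λ _ → c) r) ≡ c ℤ.* + length r
charge-row c [] = sym (ℤ.*-zeroʳ c)
charge-row c (x ∷ r) = trans (cong (λ w → c ℤ.+ w) (charge-row c r)) (e c (+ length r))
  where
  e : ∀ c n → c ℤ.+ c ℤ.* n ≡ c ℤ.* (1ℤ ℤ.+ n)
  e = ℤ-Solver.solve-∀

weight-row : ∀ (r : List (ColNat 8)) →
  sumℤ (List.map (λ x → entryWt (value x)) r) ≡ + 8 ℤ.* (+ 2 ℤ.* + sum (List.map value r) ℤ.+ + length r)
weight-row [] = refl
weight-row (x ∷ r) = trans (cong (λ w → entryWt (value x) ℤ.+ w) (weight-row r))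
  (e (+ value x) (+ sum (List.map value r)) (+ length r))
  where
  e : ∀ x s n → + 8 ℤ.* (+ 2 ℤ.* x ℤ.+ 1ℤ) ℤ.+ + 8 ℤ.* (+ 2 ℤ.* s ℤ.+ n) ≡ + 8 ℤ.* (+ 2 ℤ.* (x ℤ.+ s) ℤ.+ (1ℤ ℤ.+ n))
  e = ℤ-Solver.solve-∀

charge-arrays : ∀ t b → ch arrays (t , b) ≡ + length (proj₁ t) ℤ.- + length (proj₁ b)
charge-arrays (t , _) (b , _) = cong₂ ℤ._+_ (trans (charge-row 1ℤ t) (ℤ.*-identityˡ (+ length t)))
  (trans (charge-row (ℤ.- 1ℤ) b) (ℤ.-1*i≡-i (+ length b)))

neutral-sameLength : ∀ t b → ch arrays (t , b) ≡ 0ℤ → length (proj₁ t) ≡ length (proj₁ b)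
neutral-sameLength t b p = ℤ.+-injective (ℤ.i-j≡0⇒i≡j _ _ (trans (sym (charge-arrays t b)) p))

sameLength-neutral : ∀ t b → length (proj₁ t) ≡ length (proj₁ b) → ch arrays (t , b) ≡ 0ℤ
sameLength-neutral t b e = trans (charge-arrays t b) (ℤ.i≡j⇒i-j≡0 (cong +_ e))

frobSym : Carrier (neutral arrays) → FrobSym 8
frobSym ((t , b) , p) = frob (proj₁ t) (proj₁ b) (neutral-sameLength t b p) (proj₂ t) (proj₂ b)

frobSym-↔ : Carrier (neutral arrays) ↔ FrobSym 8
frobSym-↔ = mk↔ₛ′ frobSym
  (λ (frob t b e dt db) → ((t , dt) , (b , db)) , sameLength-neutral (t , dt) (b , db) e)
  (λ (frob t b e dt db) → cong (λ e → frob t b e dt db) (ℕ.≡-irrelevant _ e))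
  (λ _ → neutral-≡ arrays refl)

weight-frobSym : ∀ x → wt (neutral arrays) x ≡ + (16 ℕ.* weight (frobSym x))
weight-frobSym ((t , b) , p) = trans (cong₂ ℤ._+_ (weight-row (proj₁ t)) (weight-row (proj₁ b)))
  (trans (cong (λ k → + 8 ℤ.* (+ 2 ℤ.* + s ℤ.+ + m) ℤ.+ + 8 ℤ.* (+ 2 ℤ.* + s′ ℤ.+ + k)) (sym (neutral-sameLength t b p)))
    (trans (e (+ s) (+ s′) (+ m)) (sym (ℤ.pos-* 16 (m ℕ.+ s ℕ.+ s′)))))
  where
  s s′ m : ℕ
  s = sum (List.map value (proj₁ t))
  s′ = sum (List.map value (proj₁ b))
  m = length (proj₁ t)
  e : ∀ s s′ m → + 8 ℤ.* (+ 2 ℤ.* s ℤ.+ m) ℤ.+ + 8 ℤ.* (+ 2 ℤ.* s′ ℤ.+ m) ≡ + 16 ℤ.* (m ℤ.+ s ℤ.+ s′)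
  e = ℤ-Solver.solve-∀

-- The degree inside `Counts` comes out of a long chain of isomorphisms, but 16 times it is the
-- weight, and this alone identifies it with the size of the Frobenius symbol.
sized-FrobPartitions : ∀ {f} → Counts (neutral arrays) f → ∀ n → Sized (FrobPartitions 8 n) (f n)
sized-FrobPartitions (counts deg wt-deg sized) n = sized-↔ (fibre-↔ frobSym-↔ deg weight deg-weight) (sized n)
  where
  deg-weight : ∀ x → deg x ≡ weight (frobSym x)
  deg-weight x = ℕ.*-cancelˡ-≡ (deg x) (weight (frobSym x)) 16
    (ℤ.+-injective (trans (sym (wt-deg x)) (weight-frobSym x)))

theorem6p3 : (n : ℕ) → Σ ℕ (λ m → (rhs6p3 n ≡ + m) × HasCardinality (FrobPartitions 8 n) m)
theorem6p3 = sized-FrobPartitions counts-neutral-arrays
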